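{- There exists a constant $t_0$ such that for all $t\ge t_0$, with $y=e^{t e^{ -\gamma}}$, $$A(t) \le B(t) < e^{3\sqrt{y}}\, A\left(t-\frac{5e^\gamma}{\sqrt{y}}\right).$$
   Context: For real $t$, $A(t):= \lim_{N\to \infty}\frac{1}{N} |\{n\le N: \sigma(n)/n \ge t \}|$ and $B(t):= \lim_{N\to \infty}\frac{1}{N} |\{n\le N: n/\varphi(n) \ge t \}|$, where $n$ ranges over positive integers, $\sigma(n)$ is the sum of the positive divisors of $n$ and $\varphi$ is Euler's totient function. Both limits are known to exist for every $t$ and to be continuous functions of $t$. $\gamma$ is Euler's constant. -}

module Defs where

open import Level using (0ℓ; suc)
open import Algebra.Bundles using (CommutativeRing; Semiring)
open import Algebra.Definitions using (Invertible)
import Algebra.Definitions.RawSemiring as RawSemiringDefinitions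
open import Axiom.ExcludedMiddle using (ExcludedMiddle)
open import Data.Fin.Base using (toℕ)
open import Data.List.Base using (List; applyUpTo; filter; length)
import Data.Nat.ListAction as List
open import Data.Nat.Base as ℕ using (ℕ)
open import Data.Nat.Coprimality using (coprime?)
open import Data.Nat.Divisibility using (_∣?_)
open import Data.Product.Base using (∃; _×_; _,_)
open import Relation.Binary.Core using (Rel)
open import Relation.Binary.Structures using (IsTotalOrder)
import Relation.Binary.Construct.NonStrictToStrict as NonStrictToStrict
open import Relation.Nullary.Decidable.Core using (yes; no)

[1…_] : ℕ → List ℕ
[1… n ] = applyUpTo ℕ.suc n

σ : ℕ → ℕ
σ n = List.sum (filter (_∣? n) [1… n ])

φ : ℕ → ℕ
φ n = length (filter (λ k → coprime? k n) [1… n ])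

-- The field of real numbers, by its usual axioms; a model is unique up to
-- isomorphism in classical logic.
record CompleteOrderedField : Set (suc 0ℓ) where
  infix 4 _≤_
  field
    commutativeRing : CommutativeRing 0ℓ 0ℓ

  open CommutativeRing commutativeRing public

  field
    0≉1           : 0# ≉ 1#
    ≉0⇒invertible : ∀ x → x ≉ 0# → Invertible _≈_ 1# _*_ x
    _≤_           : Rel Carrier 0ℓ
    isTotalOrder  : IsTotalOrder _≈_ _≤_
    +-monoˡ-≤     : ∀ z {x y} → x ≤ y → x + z ≤ y + z
    *-nonNeg      : ∀ {x y} → 0# ≤ x → 0# ≤ y → 0# ≤ x * y

  open NonStrictToStrict _≈_ _≤_ public using (_<_)

  UpperBound : (Carrier → Set) → Carrier → Set
  UpperBound P u = ∀ x → P x → x ≤ u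

  field
    supremum : (P : Carrier → Set) → ∃ P → ∃ (UpperBound P) →
               ∃ λ s → UpperBound P s × (∀ u → UpperBound P u → s ≤ u)

module Analysis (em : ExcludedMiddle 0ℓ) (ℝ : CompleteOrderedField) where

  open CompleteOrderedField ℝ
  open RawSemiringDefinitions (Semiring.rawSemiring semiring)
    using (_^_; sum) renaming (_×_ to _·_)

  infix  4 _⟶_
  infixl 7 _/_

  fromℕ : ℕ → Carrier
  fromℕ n = n · 1#

  -- An element satisfying P, or 0# if there is none.  It is applied below only
  -- to predicates with at most one solution up to _≈_.
  the : (Carrier → Set) → Carrier
  the P with em {∃ P}
  ... | yes (x , _) = x
  ... | no  _       = 0#

  _/_ : Carrier → Carrier → Carrier
  x / y = the (λ z → y ≉ 0# × z * y ≈ x)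

  sqrt : Carrier → Carrier
  sqrt x = the (λ r → 0# ≤ r × r * r ≈ x)

  _⟶_ : (ℕ → Carrier) → Carrier → Set
  s ⟶ l = ∀ ε → 0# < ε →
    ∃ λ N → ∀ n → N ℕ.≤ n → l - ε < s n × s n < l + ε

  Convergent : (ℕ → Carrier) → Set
  Convergent s = ∃ (s ⟶_)

  lim : (ℕ → Carrier) → Carrier
  lim s = the (s ⟶_)

  ∑ : ℕ → (ℕ → Carrier) → Carrier
  ∑ n f = sum {n} (λ i → f (toℕ i))

  exp : Carrier → Carrier
  exp x = lim (λ n → ∑ n (λ k → x ^ k / fromℕ (k ℕ.!)))

  log : Carrier → Carrier
  log x = the (λ l → exp l ≈ x)

  γ : Carrier
  γ = lim (λ n → ∑ n (λ k → 1# / fromℕ (ℕ.suc k)) - log (fromℕ n))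

  proportion≥ : (ℕ → Carrier) → Carrier → ℕ → Carrier
  proportion≥ f t N =
    fromℕ (length (filter (λ n → em {t ≤ f n}) [1… N ])) / fromℕ N

  proportionσ : Carrier → ℕ → Carrier
  proportionσ = proportion≥ (λ n → fromℕ (σ n) / fromℕ n)

  proportionφ : Carrier → ℕ → Carrier
  proportionφ = proportion≥ (λ n → fromℕ n / fromℕ (φ n))

  A : Carrier → Carrier
  A t = lim (proportionσ t)

  B : Carrier → Carrier
  B t = lim (proportionφ t)

{-# OPTIONS --safe #-}

-- Since exp γ · exp (- γ) = 1, the parameter satisfies t = L exp γ with L = log y,
-- so nothing about γ is needed.  The inequality A ≤ B holds because
-- φ(n) σ(n) ≤ n².  For the upper bound on B, take z ≈ (3/2)√y and multiply every n by
-- one integer M < exp (3√y) that is divisible by all primes p ≤ z, and by a high power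
-- of each small one.  Classifying integers x by gcd(x, nM) gives
--   σ(nM)/(nM) ≥ n/φ(n) · (1 - Σ p⁻ᵉ⁻¹),
-- the sum being over the primes p dividing n, with e any exponent such that pᵉ divides nM.
-- By Chebyshev's bound for the primes in (n, 2n], the primes p > z, with e = 1, contribute
-- at most 4/(√y log y) up to smaller terms, so the factor costs less than 5 exp γ / √y
-- when n/φ(n) = t.  Hence n ↦ nM maps {n/φ(n) ≥ t} into {σ(n)/n ≥ t - 5 exp γ / √y},
-- which yields B(t) ≤ M A(t - 5 exp γ / √y); strictness holds as A is positive.
module Submission where

open import Level using (0ℓ; Level)
open import Axiom.ExcludedMiddle using (ExcludedMiddle)
open import Data.Nat.Tactic.RingSolver using (solve-∀)
open import Data.Product.Base using (Σ; ∃; ∃₂; _×_; _,_; proj₁; proj₂)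
open import Defs
open import Relation.Binary.PropositionalEquality as ≡ using (_≡_)
open import Relation.Nullary using (¬_; Dec; yes; no; contradiction)

-- The constants come from a budget. Since 16 ≤ e³, a multiplier below 16^(2q) with 2q ≤ √y stays
-- below exp (3√y), and 16^(2q) = 4^(4q). The primes up to z = 3q cost 4^(3q), by Erdős's bound for
-- the primorial; the remaining 4^q pays for the high powers of the small primes. What matters is
-- the exponent of p in n M, not in M, and only for p dividing n. Such a p in the middle range gets
-- exponent 2 from a single factor in M, so the budget need not cover squares. The middle primes
-- then lose about z / w³, where w bounds the small ones; this asks for w well above q^(2/3), while
-- the budget allows w of the order q / log q. The large primes lose 2 / (κ z) with κ near the base
-- 4 logarithm of z, that is, about 4 / (√y log y). Of the 5 in the theorem this leaves 1 for
-- rounding and for the two other ranges. Only a lower bound for σ (n M) is wanted, so the classes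
-- of the sieve may overlap. The estimate is carried out in ℕ with denominators cleared; real
-- numbers enter only afterwards.

module Arithmetic where

  open import Data.Empty using (⊥-elim)
  open import Data.List.Base using (List; []; _∷_; _++_; applyUpTo; concatMap; filter; length; map)
  open import Data.List.Membership.Propositional using (_∈_; find; lose)
  open import Data.List.Membership.Propositional.Properties
  open import Data.List.Properties
    using (applyUpTo-∷ʳ; concatMap-++; filter-++; filter-accept; length-++; length-++-sucʳ; length-applyUpTo; length-map)
  open import Data.List.Relation.Binary.Subset.Propositional using (_⊆_)
  open import Data.List.Relation.Unary.All as All using (All; []; _∷_)
  open import Data.List.Relation.Unary.AllPairs using ([]; _∷_)
  open import Data.List.Relation.Unary.Any using (here; there)
  open import Data.List.Relation.Unary.Unique.Propositional using (Unique)
  import Data.List.Relation.Unary.Unique.Propositional.Properties as Unique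
  open import Data.Nat.Base
  open import Data.Nat.Combinatorics
    using (_C_; k![n∸k]!∣n!; k>n⇒nCk≡0; nCk+nC[k+1]≡[n+1]C[k+1]; nCk≡n!/k![n-k]!)
  open import Data.Nat.Coprimality using (1-coprimeTo; Coprime; coprime?; coprime-divisor; gcd≡1⇒coprime)
  open import Data.Nat.Divisibility
  open import Data.Nat.DivMod
    using (_/_; _%_; /-monoˡ-≤; m%n<n; m*[n/m]≡n; m*n/n≡m; m/n*n≡m; m/n*n≤m; m/n≤m; m≡m%n+[m/n]*n; n/1≡n)
  open import Data.Nat.GCD using (gcd; gcd-greatest; gcd[m,n]∣m; gcd[m,n]∣n; gcd[m,n]≢0)
  open import Data.Nat.Induction using (<-rec)
  open import Data.Nat.ListAction using (product; sum)
  open import Data.Nat.ListAction.Properties using (sum-++)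
  open import Data.Nat.Primality
  open import Data.Nat.Primality.Factorisation using (factorise)
  open import Data.Nat.Properties
  open import Data.Sum.Base using (inj₁; inj₂; [_,_]′)
  open import Data.Unit.Base using (tt)
  open import Function.Base using (_∘_; id)
  open import Relation.Binary.PropositionalEquality hiding (J)
  open import Relation.Unary using (Pred; Decidable)

  private variable
    ℓ : Level
    X Y : Set ℓ

  -- Counting in finite lists

  range⁺ : ∀ {k n} → 1 ≤ k → k ≤ n → k ∈ [1… n ]
  range⁺ {suc k} _ k<n = ∈-applyUpTo⁺ suc k<n

  range⁻ : ∀ {k n} → k ∈ [1… n ] → 1 ≤ k × k ≤ n
  range⁻ k∈ with _ , i<n , refl ← ∈-applyUpTo⁻ suc k∈ = s≤s z≤n , i<n

  range-unique : ∀ n → Unique [1… n ]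
  range-unique n = Unique.applyUpTo⁺₁ suc n λ i<j _ → <⇒≢ i<j ∘ suc-injective

  ⊆⇒length≤ : {xs ys : List X} → Unique xs → xs ⊆ ys → length xs ≤ length ys
  ⊆⇒length≤ {xs = []} _ _ = z≤n
  ⊆⇒length≤ {xs = x ∷ xs} (x∉xs ∷ u) sub with ∈-∃++ (sub (here refl))
  ... | as , bs , refl = begin
    suc (length xs)          ≤⟨ s≤s (⊆⇒length≤ u sub′) ⟩
    suc (length (as ++ bs))  ≡⟨ length-++-sucʳ as x bs ⟨
    length (as ++ x ∷ bs)    ∎
    where
    open ≤-Reasoning
    sub′ : xs ⊆ as ++ bs
    sub′ y∈ with ∈-++⁻ as (sub (there y∈))
    ... | inj₁ y∈as         = ∈-++⁺ˡ y∈as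
    ... | inj₂ (here refl)  = ⊥-elim (All.lookup x∉xs y∈ refl)
    ... | inj₂ (there y∈bs) = ∈-++⁺ʳ as y∈bs

  concatMap-unique : (f : X → List Y) {ds : List X} → Unique ds →
    (∀ {d} → d ∈ ds → Unique (f d)) →
    (∀ {d e y} → d ∈ ds → e ∈ ds → y ∈ f d → y ∈ f e → d ≡ e) →
    Unique (concatMap f ds)
  concatMap-unique f {[]} _ _ _ = []
  concatMap-unique f {d ∷ ds} (d∉ds ∷ u) uf inj = Unique.++⁺ (uf (here refl))
    (concatMap-unique f u (uf ∘ there) (λ d∈ e∈ → inj (there d∈) (there e∈)))
    λ (y∈₁ , y∈₂) → let e , e∈ , y∈fe = find (∈-concatMap⁻ f {xs = ds} y∈₂)
                    in All.lookup d∉ds e∈ (inj (here refl) (there e∈) y∈₁ y∈fe)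

  ∈-concatMap : (f : X → List Y) {ds : List X} {d : X} {y : Y} →
    d ∈ ds → y ∈ f d → y ∈ concatMap f ds
  ∈-concatMap f d∈ y∈ = ∈-concatMap⁺ f (lose d∈ y∈)

  length-concatMap : (f : X → List Y) (ds : List X) →
    length (concatMap f ds) ≡ sum (map (length ∘ f) ds)
  length-concatMap f []       = refl
  length-concatMap f (d ∷ ds) = trans (length-++ (f d)) (cong (length (f d) +_) (length-concatMap f ds))

  applyUpTo-+ : (f : ℕ → X) (m n : ℕ) → applyUpTo f (m + n) ≡ applyUpTo f m ++ applyUpTo (f ∘ (m +_)) n
  applyUpTo-+ f zero    n = refl
  applyUpTo-+ f (suc m) n = cong (f 0 ∷_) (applyUpTo-+ (f ∘ suc) m n)

  length-filter-applyUpTo : ∀ {P : Pred ℕ ℓ} (P? : Decidable P) {f g : ℕ → ℕ} →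
    (∀ i → P (f i) → P (g i)) → (∀ i → P (g i) → P (f i)) → ∀ n →
    length (filter P? (applyUpTo f n)) ≡ length (filter P? (applyUpTo g n))
  length-filter-applyUpTo P? f⇒g g⇒f zero = refl
  length-filter-applyUpTo P? {f} {g} f⇒g g⇒f (suc n) with P? (f 0) | P? (g 0)
  ... | yes p | yes q = cong suc (length-filter-applyUpTo P? (f⇒g ∘ suc) (g⇒f ∘ suc) n)
  ... | no ¬p | no ¬q = length-filter-applyUpTo P? (f⇒g ∘ suc) (g⇒f ∘ suc) n
  ... | yes p | no ¬q = contradiction (f⇒g 0 p) ¬q
  ... | no ¬p | yes q = contradiction (g⇒f 0 q) ¬p

  -- Layers of integers, and φ(m) σ(m) ≤ m²

  coprimes : ℕ → ℕ → List ℕ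
  coprimes n N = filter (λ k → coprime? k n) [1… N ]

  divisors : ℕ → List ℕ
  divisors m = filter (_∣? m) [1… m ]

  -- Coprimality to n has period n, so each of the d blocks of length n contributes φ(n).
  length-coprimes-* : ∀ n d → length (coprimes n (n * d)) ≡ φ n * d
  length-coprimes-* n zero rewrite *-zeroʳ n | *-zeroʳ (φ n) = refl
  length-coprimes-* n (suc d) = begin
    length (coprimes n (n * suc d))
      ≡⟨ cong (length ∘ coprimes n) (*-suc n d) ⟩
    length (filter cop? (applyUpTo suc (n + n * d)))
      ≡⟨ cong (length ∘ filter cop?) (applyUpTo-+ suc n (n * d)) ⟩
    length (filter cop? ([1… n ] ++ applyUpTo (suc ∘ (n +_)) (n * d)))
      ≡⟨ cong length (filter-++ cop? [1… n ] _) ⟩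
    length (coprimes n n ++ filter cop? (applyUpTo (suc ∘ (n +_)) (n * d)))
      ≡⟨ length-++ (coprimes n n) ⟩
    φ n + length (filter cop? (applyUpTo (suc ∘ (n +_)) (n * d)))
      ≡⟨ cong (φ n +_) (length-filter-applyUpTo cop? shift⁻ shift⁺ (n * d)) ⟩
    φ n + length (coprimes n (n * d))
      ≡⟨ cong (φ n +_) (length-coprimes-* n d) ⟩
    φ n + φ n * d
      ≡⟨ *-suc (φ n) d ⟨
    φ n * suc d ∎
    where
    open ≡-Reasoning
    cop? : Decidable (λ k → Coprime k n)
    cop? k = coprime? k n
    shift⁻ : ∀ i → Coprime (suc (n + i)) n → Coprime (suc i) n
    shift⁻ i c {j} (j∣i , j∣n) = c (subst (j ∣_) (+-suc n i) (∣m∣n⇒∣m+n j∣n j∣i) , j∣n)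
    shift⁺ : ∀ i → Coprime (suc i) n → Coprime (suc (n + i)) n
    shift⁺ i c {j} (j∣i , j∣n) = c (∣m+n∣m⇒∣n (subst (j ∣_) (sym (+-suc n i)) j∣i) j∣n , j∣n)

  -- The value at 0 is a dummy that makes the quotient total; the members of `divisors m` are
  -- positive.
  cofactor : ℕ → ℕ → ℕ
  cofactor m zero    = 0
  cofactor m (suc d) = m / suc d

  cofactor-* : ∀ {m d} → d ∈ divisors m → cofactor m d * d ≡ m
  cofactor-* {m} {d} d∈ with ∈-filter⁻ (_∣? m) {xs = [1… m ]} d∈
  cofactor-* {m} {zero}  d∈ | d∈r , _   = contradiction (proj₁ (range⁻ d∈r)) λ ()
  cofactor-* {m} {suc d} d∈ | _   , d∣m = trans (*-comm (m / suc d) (suc d)) (m*[n/m]≡n d∣m)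

  -- For d dividing m these are the x with x / m = k / d for some k coprime to n, where k ≤ n d
  -- amounts to x ≤ n m. There are φ(n) d of them, so that summing over d gives φ(n) σ(m).
  layer : ℕ → ℕ → ℕ → List ℕ
  layer n m d = map (cofactor m d *_) (coprimes n (n * d))

  layers : ℕ → ℕ → List ℕ
  layers n m = concatMap (layer n m) (divisors m)

  length-layers : ∀ n m → length (layers n m) ≡ φ n * σ m
  length-layers n m = trans (length-concatMap (layer n m) (divisors m)) (go (divisors m))
    where
    go : ∀ ds → sum (map (length ∘ layer n m) ds) ≡ φ n * sum ds
    go []       = sym (*-zeroʳ (φ n))
    go (d ∷ ds) = trans (cong₂ _+_ (trans (length-map _ (coprimes n (n * d))) (length-coprimes-* n d)) (go ds))
                        (sym (*-distribˡ-+ (φ n) d (sum ds)))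

  ∈-layer⁻ : ∀ {n m d x} → x ∈ layer n m d →
    ∃ λ k → 1 ≤ k × k ≤ n * d × Coprime k n × x ≡ cofactor m d * k
  ∈-layer⁻ {n} {m} {d} x∈ =
    let k , k∈ , eq = ∈-map⁻ (cofactor m d *_) x∈
        k∈r , cop   = ∈-filter⁻ (λ k → coprime? k n) {xs = [1… n * d ]} k∈
        1≤k , k≤    = range⁻ k∈r
    in k , 1≤k , k≤ , (λ {i} → cop {i}) , eq

  -- For n = m the layers are disjoint subsets of the integers up to m²: in x = c k with c dividing
  -- m and k coprime to m, the cofactor c is the gcd of x and m and hence determined by x.
  φ*σ≤m*m : ∀ m → .{{NonZero m}} → φ m * σ m ≤ m * m
  φ*σ≤m*m m = begin
    φ m * σ m            ≡⟨ length-layers m m ⟨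
    length (layers m m)  ≤⟨ ⊆⇒length≤ unique bounded ⟩
    length [1… m * m ]   ≡⟨ length-applyUpTo suc (m * m) ⟩
    m * m                ∎
    where
    open ≤-Reasoning
    cofactor≢0 : ∀ {d} → d ∈ divisors m → NonZero (cofactor m d)
    cofactor≢0 d∈ = m*n≢0⇒m≢0 _ {{subst NonZero (sym (cofactor-* d∈)) it}}
      where
      it : NonZero m
      it = >-nonZero (>-nonZero⁻¹ m)
    cofactor∣m : ∀ {d} → d ∈ divisors m → cofactor m d ∣ m
    cofactor∣m {d} d∈ = subst (cofactor m d ∣_) (cofactor-* d∈) (m∣m*n d)
    half : ∀ {d e x} → d ∈ divisors m → x ∈ layer m m d → x ∈ layer m m e →
           cofactor m d ∣ cofactor m e
    half {d} {e} d∈ x∈d x∈e with ∈-layer⁻ {m} {m} {d} x∈d | ∈-layer⁻ {m} {m} {e} x∈e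
    ... | k , _ , _ , _ , refl | l , _ , _ , cop , eq =
      coprime-divisor (λ (i∣c , i∣l) → cop (i∣l , ∣-trans i∣c (cofactor∣m d∈)))
        (subst (cofactor m d ∣_) (trans eq (*-comm (cofactor m e) l)) (m∣m*n k))
    disjoint : ∀ {d e x} → d ∈ divisors m → e ∈ divisors m →
               x ∈ layer m m d → x ∈ layer m m e → d ≡ e
    disjoint {d} {e} d∈ e∈ x∈d x∈e = *-cancelˡ-≡ d e (cofactor m d) {{cofactor≢0 d∈}} (trans (cofactor-* d∈)
        (trans (sym (cofactor-* e∈)) (cong (_* e) (∣-antisym (half e∈ x∈e x∈d) (half d∈ x∈d x∈e)))))
    unique : Unique (layers m m)
    unique = concatMap-unique (layer m m) (Unique.filter⁺ (_∣? m) (range-unique m))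
      (λ {d} d∈ → Unique.map⁺ (*-cancelˡ-≡ _ _ (cofactor m d) {{cofactor≢0 d∈}})
         (Unique.filter⁺ (λ k → coprime? k m) (range-unique (m * d))))
      disjoint
    bounded : layers m m ⊆ [1… m * m ]
    bounded x∈ with find (∈-concatMap⁻ (layer m m) {xs = divisors m} x∈)
    ... | d , d∈ , x∈d with ∈-layer⁻ {m} {m} {d} x∈d
    ... | k , 1≤k , k≤ , _ , refl = range⁺
      (*-mono-≤ (>-nonZero⁻¹ _ {{cofactor≢0 d∈}}) 1≤k)
      (begin
        cofactor m d * k        ≤⟨ *-monoʳ-≤ (cofactor m d) k≤ ⟩
        cofactor m d * (m * d)  ≡⟨ cong (cofactor m d *_) (*-comm m d) ⟩
        cofactor m d * (d * m)  ≡⟨ *-assoc (cofactor m d) d m ⟨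
        cofactor m d * d * m    ≡⟨ cong (_* m) (cofactor-* d∈) ⟩
        m * m                   ∎)

  -- The sieve inequality

  multiples : ℕ → ℕ → List ℕ
  multiples N zero    = []
  multiples N (suc g) = map (suc g *_) [1… N / suc g ]

  length-multiples : ∀ N g → length (multiples N g) * g ≤ N
  length-multiples N zero    = z≤n
  length-multiples N (suc g) = begin
    length (multiples N (suc g)) * suc g  ≡⟨ cong (_* suc g) (trans (length-map _ [1… N / suc g ]) (length-applyUpTo suc (N / suc g))) ⟩
    N / suc g * suc g                     ≤⟨ m/n*n≤m N (suc g) ⟩
    N                                     ∎
    where open ≤-Reasoning

  ∈-multiples : ∀ {N g x} → 1 ≤ x → x ≤ N → g ∣ x → x ∈ multiples N g
  ∈-multiples {g = zero} 1≤x _ g∣x with refl ← 0∣⇒≡0 g∣x = contradiction 1≤x λ ()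
  ∈-multiples {N} {suc g} 1≤x x≤N (divides q refl) = subst (_∈ multiples N (suc g)) (*-comm (suc g) q)
    (∈-map⁺ (suc g *_) (range⁺ (n≢0⇒n>0 λ { refl → contradiction 1≤x λ () })
      (subst (_≤ N / suc g) (m*n/n≡m q (suc g)) (/-monoˡ-≤ (suc g) x≤N))))

  -- A count with repetition: a number is counted once for every entry of `gs` that divides it. This
  -- makes it additive in `gs` and bounded by the sum of the N / g.
  sifted : ℕ → List ℕ → ℕ
  sifted N gs = length (concatMap (multiples N) gs)

  prime-divisor : ∀ n → .{{NonZero n}} → n ≢ 1 → ∃ λ p → Prime p × p ∣ n
  prime-divisor n n≢1 with factorise n
  ... | record { factors = [] ; isFactorisation = eq } = contradiction eq n≢1
  ... | record { factors = p ∷ ps ; isFactorisation = eq ; factorsPrime = pp ∷ _ } =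
    p , pp , subst (p ∣_) (sym eq) (m∣m*n (product ps))

  prime^-cancel : ∀ {p d} → Prime p → p ∤ d → ∀ e g → p ^ e ∣ d * g → p ^ e ∣ g
  prime^-cancel pp p∤d zero g _ = 1∣ g
  prime^-cancel {p} {d} pp p∤d (suc e) g p^∣ with euclidsLemma d g pp (m*n∣⇒m∣ p (p ^ e) p^∣)
  ... | inj₁ p∣d = contradiction p∣d p∤d
  ... | inj₂ (divides h refl) = subst (_∣ h * p) (*-comm (p ^ e) p)
    (*-monoˡ-∣ p (prime^-cancel pp p∤d e h (*-cancelʳ-∣ p {{prime⇒nonZero pp}}
      (subst₂ _∣_ (*-comm p (p ^ e)) (sym (*-assoc d h p)) p^∣))))

  -- Every x ≤ n m lies in the layer of d = m / gcd x m, unless a prime p dividing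
  -- both n and x / gcd x m exists; then p does not divide d, so that every power
  -- p ^ e dividing m divides gcd x m, and p ^ suc e divides x.
  sieve : ∀ n m → .{{NonZero n}} → .{{NonZero m}} → (gs : List ℕ) →
    (∀ {p} → Prime p → p ∣ n → ∃ λ e → p ^ e ∣ m × p ^ suc e ∈ gs) →
    n * m ≤ φ n * σ m + sifted (n * m) gs
  sieve n m gs cover = begin
    n * m                                       ≡⟨ length-applyUpTo suc (n * m) ⟨
    length [1… n * m ]                          ≤⟨ ⊆⇒length≤ (range-unique (n * m)) covered ⟩
    length (layers n m ++ concatMap (multiples (n * m)) gs)
      ≡⟨ length-++ (layers n m) ⟩
    length (layers n m) + sifted (n * m) gs     ≡⟨ cong (_+ sifted (n * m) gs) (length-layers n m) ⟩
    φ n * σ m + sifted (n * m) gs               ∎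
    where
    open ≤-Reasoning
    covered : [1… n * m ] ⊆ layers n m ++ concatMap (multiples (n * m)) gs
    covered {x} x∈ with range⁻ x∈
    ... | 1≤x , x≤nm = go (gcd[m,n]∣m x m) (gcd[m,n]∣n x m) coprime
      where
      instance
        g≢0 : NonZero (gcd x m)
        g≢0 = ≢-nonZero (gcd[m,n]≢0 x m (inj₁ λ { refl → contradiction 1≤x λ () }))
      coprime : ∀ {k d} → x ≡ k * gcd x m → m ≡ d * gcd x m → Coprime k d
      coprime {k} {d} xeq meq {i} (i∣k , i∣d) =
        ∣1⇒≡1 (*-cancelʳ-∣ (gcd x m) (subst (i * gcd x m ∣_) (sym (*-identityˡ (gcd x m))) (gcd-greatest
          (subst (i * gcd x m ∣_) (sym xeq) (*-monoˡ-∣ (gcd x m) i∣k))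
          (subst (i * gcd x m ∣_) (sym meq) (*-monoˡ-∣ (gcd x m) i∣d)))))
      go : ∀ {g} → .{{NonZero g}} → g ∣ x → g ∣ m → (∀ {k d} → x ≡ k * g → m ≡ d * g → Coprime k d) →
           x ∈ layers n m ++ concatMap (multiples (n * m)) gs
      go {g} (divides k xeq) (divides d meq) cop with coprime? k n
      ... | yes k⊥n = ∈-++⁺ˡ (∈-concatMap (layer n m) d∈ (subst (_∈ layer n m d)
            (trans (cong (_* k) cofactor≡g) (trans (*-comm g k) (sym xeq)))
            (∈-map⁺ (cofactor m d *_) (∈-filter⁺ (λ k → coprime? k n) (range⁺ 1≤k k≤nd) λ {i} → k⊥n {i}))))
        where
        1≤d : 1 ≤ d
        1≤d = n≢0⇒n>0 λ { refl → contradiction meq (m<n⇒n≢0 (>-nonZero⁻¹ m)) }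
        1≤k : 1 ≤ k
        1≤k = n≢0⇒n>0 λ { refl → contradiction xeq (m<n⇒n≢0 1≤x) }
        d∣m : d ∣ m
        d∣m = divides g (trans meq (*-comm d g))
        d∈ : d ∈ divisors m
        d∈ = ∈-filter⁺ (_∣? m) (range⁺ 1≤d (∣⇒≤ d∣m)) d∣m
        cofactor≡g : cofactor m d ≡ g
        cofactor≡g = *-cancelʳ-≡ _ _ d {{>-nonZero 1≤d}} (trans (cofactor-* d∈) (trans meq (*-comm d g)))
        k≤nd : k ≤ n * d
        k≤nd = *-cancelʳ-≤ k (n * d) g (begin
          k * g        ≡⟨ xeq ⟨
          x            ≤⟨ x≤nm ⟩
          n * m        ≡⟨ cong (n *_) meq ⟩
          n * (d * g)  ≡⟨ *-assoc n d g ⟨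
          n * d * g    ∎)
      ... | no ¬k⊥n = ∈-++⁺ʳ (layers n m) (∈-concatMap (multiples (n * m)) p^∈
            (∈-multiples 1≤x x≤nm (subst (p ^ suc e ∣_) (sym xeq) (*-pres-∣ p∣k p^e∣g))))
        where
        c : ∃ λ p → Prime p × p ∣ gcd k n
        c = prime-divisor (gcd k n) {{≢-nonZero (gcd[m,n]≢0 k n (inj₂ (m<n⇒n≢0 (>-nonZero⁻¹ n))))}}
              λ eq → ¬k⊥n (λ {i} → gcd≡1⇒coprime eq {i})
        p = proj₁ c
        pp = proj₁ (proj₂ c)
        p∣k : p ∣ k
        p∣k = ∣-trans (proj₂ (proj₂ c)) (gcd[m,n]∣m k n)
        found = cover pp (∣-trans (proj₂ (proj₂ c)) (gcd[m,n]∣n k n))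
        e = proj₁ found
        p^∈ = proj₂ (proj₂ found)
        p∤d : p ∤ d
        p∤d p∣d = contradiction (subst Prime (cop xeq meq (p∣k , p∣d)) pp) ¬prime[1]
        p^e∣g : p ^ e ∣ g
        p^e∣g = prime^-cancel pp p∤d e g (subst (p ^ e ∣_) meq (proj₁ (proj₂ found)))

  -- Binomial coefficients and the primorial

  prime∤! : ∀ {p} → Prime p → ∀ {n} → n < p → p ∤ n !
  prime∤! pp {zero}  n<p p∣ = contradiction (subst Prime (∣1⇒≡1 p∣) pp) ¬prime[1]
  prime∤! pp {suc n} n<p p∣ = [ (λ p∣n → ≤⇒≯ (∣⇒≤ p∣n) n<p) , prime∤! pp (m<n⇒m<1+n⁻ n<p) ]′
    (euclidsLemma (suc n) (n !) pp p∣)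
    where
    m<n⇒m<1+n⁻ : ∀ {m n} → suc m < n → m < n
    m<n⇒m<1+n⁻ = <-trans (n<1+n _)

  choose-! : ∀ a b → ((a + b) C a) * (a ! * b !) ≡ (a + b) !
  choose-! a b = begin
    ((a + b) C a) * (a ! * b !)              ≡⟨ cong (λ c → ((a + b) C a) * (a ! * c !)) (m+n∸m≡n a b) ⟨
    ((a + b) C a) * (a ! * (a + b ∸ a) !)    ≡⟨ cong (_* (a ! * (a + b ∸ a) !)) (nCk≡n!/k![n-k]! (m≤m+n a b)) ⟩
    _                                      ≡⟨ m/n*n≡m (k![n∸k]!∣n! (m≤m+n a b)) ⟩
    (a + b) ! ∎
    where
    open ≡-Reasoning
    instance _ = a !* (a + b ∸ a) !≢0

  choose≢0 : ∀ a b → NonZero ((a + b) C a)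
  choose≢0 a b = m*n≢0⇒m≢0 _ {{subst NonZero (sym (choose-! a b)) ((a + b) !≢0)}}

  -- The prime divides (a + b)!, but neither a! nor b!, since both a and b are smaller than p.
  prime∣choose : ∀ {p a b} → Prime p → a ≤ b → b < p → p ≤ a + b → p ∣ (a + b) C a
  prime∣choose {p} {a} {b} pp a≤b b<p p≤ with euclidsLemma ((a + b) C a) (a ! * b !) pp p∣*
    where
    p∣p! : ∀ p → .{{NonZero p}} → p ∣ p !
    p∣p! (suc p) = m∣m*n (p !)
    p∣* : p ∣ ((a + b) C a) * (a ! * b !)
    p∣* = subst (p ∣_) (sym (choose-! a b)) (∣-trans (p∣p! p {{prime⇒nonZero pp}}) (m≤n⇒m!∣n! p≤))
  ... | inj₁ p∣C = p∣C
  ... | inj₂ p∣! = contradiction p∣!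
    ([ prime∤! pp (≤-<-trans a≤b b<p) , prime∤! pp b<p ]′ ∘ euclidsLemma (a !) (b !) pp)

  -- Row 1 of Pascal's triangle has entries at most 1, and passing to the next row at most doubles
  -- the maximum. The exponent is one less than the row number; this saving is what makes
  -- `choose≤4^` hold even when b = a + 1.
  choose≤2^ : ∀ n k → suc n C k ≤ 2 ^ n
  choose≤2^ n zero = m^n>0 2 n
  choose≤2^ zero (suc k) = begin
    1 C suc k          ≡⟨ nCk+nC[k+1]≡[n+1]C[k+1] 0 k ⟨
    0 C k + 0 C suc k  ≡⟨ cong (0 C k +_) (k>n⇒nCk≡0 {0} {suc k} (s≤s z≤n)) ⟩
    0 C k + 0          ≤⟨ 0Ck≤1 k ⟩
    1                  ∎
    where
    open ≤-Reasoning
    0Ck≤1 : ∀ k → 0 C k + 0 ≤ 1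
    0Ck≤1 zero    = ≤-refl
    0Ck≤1 (suc k) = ≤-trans (≤-reflexive (cong (_+ 0) (k>n⇒nCk≡0 {0} {suc k} (s≤s z≤n)))) z≤n
  choose≤2^ (suc n) (suc k) = begin
    suc (suc n) C suc k        ≡⟨ nCk+nC[k+1]≡[n+1]C[k+1] (suc n) k ⟨
    suc n C k + suc n C suc k  ≤⟨ +-mono-≤ (choose≤2^ n k) (choose≤2^ n (suc k)) ⟩
    2 ^ n + 2 ^ n              ≡⟨ cong (2 ^ n +_) (+-identityʳ (2 ^ n)) ⟨
    2 ^ suc n                  ∎
    where open ≤-Reasoning

  choose≤4^ : ∀ {a b} → 1 ≤ b → b ≤ suc a → (a + b) C a ≤ 4 ^ a
  choose≤4^ {a} {suc b} _ (s≤s b≤a) = begin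
    (a + suc b) C a   ≡⟨ cong (_C a) (+-suc a b) ⟩
    suc (a + b) C a   ≤⟨ choose≤2^ (a + b) a ⟩
    2 ^ (a + b)       ≤⟨ ^-monoʳ-≤ 2 (+-monoʳ-≤ a b≤a) ⟩
    2 ^ (a + a)       ≡⟨ cong (λ c → 2 ^ (a + c)) (+-identityʳ a) ⟨
    2 ^ (2 * a)       ≡⟨ ^-*-assoc 2 2 a ⟨
    4 ^ a             ∎
    where open ≤-Reasoning

  -- A common multiple of the primes up to z is enough; the construction below yields a product of
  -- binomial coefficients instead of the product of the primes.
  record Primorial (z : ℕ) : Set where
    field
      bound   : ℕ
      bound≢0 : NonZero bound
      ≤4^     : bound ≤ 4 ^ z
      prime∣  : ∀ {p} → Prime p → p ≤ z → p ∣ bound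

  -- Erdős's induction by halving: the primes in (⌈z/2⌉, z] divide the binomial coefficient of z
  -- over ⌊z/2⌋, which is at most 4^⌊z/2⌋, and the recursive call at ⌈z/2⌉ covers the rest. The two
  -- exponents add up to z.
  primorial : ∀ z → Primorial z
  primorial = <-rec Primorial step
    where
    small : ∀ z → z ≤ 1 → Primorial z
    small z z≤1 = record
      { bound = 1 ; bound≢0 = _ ; ≤4^ = m^n>0 4 z
      ; prime∣ = λ {p} pp p≤z → contradiction (≤-trans (nonTrivial⇒n>1 p {{prime⇒nonTrivial pp}}) (≤-trans p≤z z≤1)) 1+n≰n }
    step : ∀ z → (∀ {y} → y < z → Primorial y) → Primorial z
    step 0 _ = small 0 z≤n
    step 1 _ = small 1 ≤-refl
    step z@(suc (suc y)) rec = record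
      { bound   = ((a + b) C a) * G.bound
      ; bound≢0 = m*n≢0 _ _ {{choose≢0 a b}} {{G.bound≢0}}
      ; ≤4^     = ≤-trans (*-mono-≤ (choose≤4^ {a} {b} (s≤s z≤n) (s≤s b≤1+a′)) G.≤4^)
                    (≤-reflexive (trans (sym (^-distribˡ-+-* 4 a b)) (cong (4 ^_) a+b≡z)))
      ; prime∣  = λ {p} → divides-bound {p}
      }
      where
      a = ⌊ z /2⌋
      b = ⌈ z /2⌉
      a+b≡z : a + b ≡ z
      a+b≡z = ⌊n/2⌋+⌈n/2⌉≡n z
      b≤1+a′ : ⌈ y /2⌉ ≤ suc ⌊ y /2⌋
      b≤1+a′ = ⌊n/2⌋-mono (n≤1+n (suc y))
      module G = Primorial (rec (⌈n/2⌉<n y))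
      divides-bound : ∀ {p} → Prime p → p ≤ z → p ∣ ((a + b) C a) * G.bound
      divides-bound {p} pp p≤z with p ≤? b
      ... | yes p≤b = ∣n⇒∣m*n ((a + b) C a) (G.prime∣ pp p≤b)
      ... | no  p≰b = ∣m⇒∣m*n G.bound (prime∣choose pp (⌊n/2⌋≤⌈n/2⌉ z) (≰⇒> p≰b)
                        (subst (p ≤_) (sym a+b≡z) p≤z))

  -- Chebyshev's bound in dyadic intervals

  prime∣prime⇒≡ : ∀ {p q} → Prime p → Prime q → p ∣ q → p ≡ q
  prime∣prime⇒≡ pp pq p∣q with prime⇒irreducible pq p∣q
  ... | inj₁ refl = contradiction pp ¬prime[1]
  ... | inj₂ p≡q  = p≡q

  product-distinct-primes∣ : ∀ {ps} → Unique ps → All Prime ps → ∀ {n} → All (_∣ n) ps → product ps ∣ n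
  product-distinct-primes∣ {[]} _ _ {n} _ = 1∣ n
  product-distinct-primes∣ {p ∷ ps} (p∉ ∷ u) (pp ∷ pps) (divides m refl ∷ ps∣) =
    subst (_∣ m * p) (*-comm (product ps) p) (*-monoˡ-∣ p
      (product-distinct-primes∣ u pps (All.tabulate λ q∈ →
        [ id , (λ q∣p → contradiction (sym (prime∣prime⇒≡ (All.lookup pps q∈) pp q∣p)) (All.lookup p∉ q∈)) ]′
          (euclidsLemma m p (All.lookup pps q∈) (All.lookup ps∣ q∈)))))

  length≤product : ∀ {n ps} → All (n ≤_) ps → n ^ length ps ≤ product ps
  length≤product []         = ≤-refl
  length≤product (n≤ ∷ ns≤) = *-mono-≤ n≤ (length≤product ns≤)

  interval : ℕ → ℕ → List ℕ
  interval m n = applyUpTo (suc ∘ (m +_)) n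

  interval⁺ : ∀ {m n k} → m < k → k ≤ m + n → k ∈ interval m n
  interval⁺ {m} {n} {k} m<k k≤ = subst (_∈ interval m n) (m+[n∸m]≡n m<k)
    (∈-applyUpTo⁺ (suc ∘ (m +_)) (+-cancelˡ-≤ m (suc (k ∸ suc m)) n
      (≤-trans (≤-reflexive (trans (+-suc m (k ∸ suc m)) (m+[n∸m]≡n m<k))) k≤)))

  interval⁻ : ∀ {m n k} → k ∈ interval m n → m < k × k ≤ m + n
  interval⁻ {m} k∈ with i , i<n , refl ← ∈-applyUpTo⁻ (suc ∘ (m +_)) k∈ =
    s≤s (m≤m+n m i) , ≤-trans (≤-reflexive (sym (+-suc m i))) (+-monoʳ-≤ m i<n)

  dyadicPrimes : ℕ → List ℕ
  dyadicPrimes n = filter prime? (interval n n)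

  dyadicPrimes⁻ : ∀ n {p} → p ∈ dyadicPrimes n → Prime p × n < p × p ≤ n + n
  dyadicPrimes⁻ n p∈ = let p∈i , pp = ∈-filter⁻ prime? {xs = interval n n} p∈ in pp , interval⁻ p∈i

  -- Chebyshev: n ^ P ≤ ∏ p ≤ C(2n, n) ≤ 4 ^ n for the P primes p in (n, 2n].
  length-dyadicPrimes : ∀ {κ n} → 4 ^ κ ≤ n → κ * length (dyadicPrimes n) ≤ n
  length-dyadicPrimes {κ} {n} 4^κ≤n = ≮⇒≥ λ n<κP → <⇒≱ (^-monoʳ-< 4 (s≤s (s≤s z≤n)) n<κP) (begin
    4 ^ (κ * P)                  ≡⟨ ^-*-assoc 4 κ P ⟨
    (4 ^ κ) ^ P                  ≤⟨ ^-monoˡ-≤ P 4^κ≤n ⟩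
    n ^ P                        ≤⟨ length≤product {n} (All.tabulate λ p∈ → <⇒≤ (proj₁ (proj₂ (dyadicPrimes⁻ n p∈)))) ⟩
    product (dyadicPrimes n)     ≤⟨ ∣⇒≤ {{choose≢0 n n}} (product-distinct-primes∣
                                      (Unique.filter⁺ prime? (Unique.applyUpTo⁺₁ _ n λ i<j _ → <⇒≢ i<j ∘ +-cancelˡ-≡ n _ _ ∘ suc-injective))
                                      (All.tabulate (proj₁ ∘ dyadicPrimes⁻ n))
                                      (All.tabulate λ p∈ → let pp , n<p , p≤ = dyadicPrimes⁻ n p∈ in prime∣choose {a = n} {n} pp ≤-refl n<p p≤)) ⟩
    (n + n) C n                  ≤⟨ choose≤4^ (≤-trans (m^n>0 4 κ) 4^κ≤n) (n≤1+n n) ⟩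
    4 ^ n                        ∎)
    where
    open ≤-Reasoning
    P = length (dyadicPrimes n)

  -- Multiples of the squares of large primes

  sifted-++ : ∀ N gs hs → sifted N (gs ++ hs) ≡ sifted N gs + sifted N hs
  sifted-++ N gs hs = trans (cong length (concatMap-++ (multiples N) gs hs))
    (length-++ (concatMap (multiples N) gs))

  sifted-≤ : ∀ {N D gs} → All (D ≤_) gs → sifted N gs * D ≤ length gs * N
  sifted-≤ [] = z≤n
  sifted-≤ {N} {D} {g ∷ gs} (D≤g ∷ D≤gs) = begin
    sifted N (g ∷ gs) * D
      ≡⟨ cong (_* D) (length-++ (multiples N g)) ⟩
    (length (multiples N g) + sifted N gs) * D
      ≡⟨ *-distribʳ-+ D (length (multiples N g)) (sifted N gs) ⟩
    length (multiples N g) * D + sifted N gs * D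
      ≤⟨ +-mono-≤ (≤-trans (*-monoʳ-≤ (length (multiples N g)) D≤g) (length-multiples N g)) (sifted-≤ D≤gs) ⟩
    N + length gs * N ∎
    where open ≤-Reasoning

  sifted-map-≤ : ∀ {N D} (f : ℕ → ℕ) ks → (∀ {k} → k ∈ ks → D ≤ f k) →
    sifted N (map f ks) * D ≤ length ks * N
  sifted-map-≤ {N} {D} f ks D≤ = subst (λ l → sifted N (map f ks) * D ≤ l * N) (length-map f ks)
    (sifted-≤ (All.tabulate λ g∈ → let k , k∈ , eq = ∈-map⁻ f g∈ in subst (D ≤_) (sym eq) (D≤ k∈)))

  -- The squares of the primes in (z, z 2^J], collected in dyadic blocks because Chebyshev's bound
  -- is applied to each block separately.
  primeSquares : ℕ → ℕ → List ℕ
  primeSquares z zero    = []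
  primeSquares z (suc J) = map (_^ 2) (dyadicPrimes (z * 2 ^ J)) ++ primeSquares z J

  z*2^1+J : ∀ z J → z * 2 ^ suc J ≡ z * 2 ^ J + z * 2 ^ J
  z*2^1+J z J = lemma z (2 ^ J)
    where
    lemma : ∀ z x → z * (2 * x) ≡ z * x + z * x
    lemma = solve-∀

  ∈-primeSquares : ∀ {z p} → Prime p → z < p → ∀ J → p ≤ z * 2 ^ J → p ^ 2 ∈ primeSquares z J
  ∈-primeSquares {z} pp z<p zero p≤ = contradiction (≤-trans z<p (≤-trans p≤ (≤-reflexive (*-identityʳ z)))) 1+n≰n
  ∈-primeSquares {z} {p} pp z<p (suc J) p≤ with p ≤? z * 2 ^ J
  ... | yes p≤J = ∈-++⁺ʳ (map (_^ 2) (dyadicPrimes (z * 2 ^ J))) (∈-primeSquares pp z<p J p≤J)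
  ... | no  p≰J = ∈-++⁺ˡ (∈-map⁺ (_^ 2) (∈-filter⁺ prime? (interval⁺ (≰⇒> p≰J)
                    (subst (p ≤_) (z*2^1+J z J) p≤)) pp))

  -- There are at most n / κ primes in the block, and the square of each has at most N / n²
  -- multiples up to N.
  sifted-dyadicPrimes : ∀ {N κ n} → .{{NonZero n}} → 4 ^ κ ≤ n →
    κ * sifted N (map (_^ 2) (dyadicPrimes n)) * n ≤ N
  sifted-dyadicPrimes {N} {κ} {n} 4^κ≤n = *-cancelʳ-≤ (κ * s * n) N n (begin
    κ * s * n * n  ≡⟨ lemma₁ κ s n ⟩
    κ * (s * n ^ 2)  ≤⟨ *-monoʳ-≤ κ (sifted-map-≤ (_^ 2) (dyadicPrimes n) λ p∈ →
                         ^-monoˡ-≤ 2 (<⇒≤ (proj₁ (proj₂ (dyadicPrimes⁻ n p∈))))) ⟩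
    κ * (P * N)      ≡⟨ *-assoc κ P N ⟨
    κ * P * N        ≤⟨ *-monoˡ-≤ N (length-dyadicPrimes {κ} 4^κ≤n) ⟩
    n * N            ≡⟨ *-comm n N ⟩
    N * n            ∎)
    where
    open ≤-Reasoning
    P = length (dyadicPrimes n)
    s = sifted N (map (_^ 2) (dyadicPrimes n))
    lemma₁ : ∀ κ s n → κ * s * n * n ≡ κ * (s * (n * (n * 1)))
    lemma₁ = solve-∀

  -- The block starting at z 2^i contributes at most N / (κ z 2^i). The geometric series is bounded
  -- by 2 N / (κ z), whatever the number of blocks.
  sifted-primeSquares : ∀ {N κ z} → .{{NonZero z}} → 4 ^ κ ≤ z → ∀ J →
    κ * z * sifted N (primeSquares z J) ≤ 2 * N
  sifted-primeSquares {N} {κ} {z} 4^κ≤z J = *-cancelʳ-≤ _ _ (2 ^ J) {{m^n≢0 2 J}} (≤-trans (m≤m+n _ (2 * N)) (go J))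
    where
    open ≤-Reasoning
    lemma₁ : ∀ κ z s t u N → κ * z * (s + t) * (2 * u) + 2 * N ≡ 2 * (κ * s * (z * u)) + 2 * (κ * z * t * u) + 2 * N
    lemma₁ = solve-∀
    lemma₂ : ∀ κ z t u N → 2 * N + 2 * (κ * z * t * u) + 2 * N ≡ 2 * (κ * z * t * u + 2 * N)
    lemma₂ = solve-∀
    lemma₃ : ∀ u N → 2 * (2 * N * u) ≡ 2 * N * (2 * u)
    lemma₃ = solve-∀
    -- The bound strengthened by the factor 1 - 2^(-J), without which the induction would not close.
    go : ∀ J → κ * z * sifted N (primeSquares z J) * 2 ^ J + 2 * N ≤ 2 * N * 2 ^ J
    go zero = ≤-reflexive (trans (cong (λ x → x * 1 + 2 * N) (*-zeroʳ (κ * z))) (sym (*-identityʳ (2 * N))))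
    go (suc J) = begin
      κ * z * sifted N (primeSquares z (suc J)) * 2 ^ suc J + 2 * N
        ≡⟨ cong (λ x → κ * z * x * 2 ^ suc J + 2 * N) (sifted-++ N (map (_^ 2) (dyadicPrimes (z * u))) (primeSquares z J)) ⟩
      κ * z * (s + t) * (2 * u) + 2 * N
        ≡⟨ lemma₁ κ z s t u N ⟩
      2 * (κ * s * (z * u)) + 2 * (κ * z * t * u) + 2 * N
        ≤⟨ +-monoˡ-≤ (2 * N) (+-monoˡ-≤ (2 * (κ * z * t * u)) (*-monoʳ-≤ 2
             (sifted-dyadicPrimes {N} {κ} {z * u} {{m*n≢0 z u {{it}} {{m^n≢0 2 J}}}}
               (≤-trans 4^κ≤z (m≤m*n z u {{m^n≢0 2 J}}))))) ⟩
      2 * N + 2 * (κ * z * t * u) + 2 * N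
        ≡⟨ lemma₂ κ z t u N ⟩
      2 * (κ * z * t * u + 2 * N)
        ≤⟨ *-monoʳ-≤ 2 (go J) ⟩
      2 * (2 * N * u)
        ≡⟨ lemma₃ u N ⟩
      2 * N * 2 ^ suc J ∎
      where
      u = 2 ^ J
      s = sifted N (map (_^ 2) (dyadicPrimes (z * u)))
      t = sifted N (primeSquares z J)
      it : NonZero z
      it = >-nonZero (≤-trans (m^n>0 4 κ) 4^κ≤z)

  -- Construction of the multiplier M

  absorb : ∀ {T D c e N} → .{{NonZero D}} → T * D ≤ c * N → e * c ≤ D → e * T ≤ N
  absorb {T} {D} {c} {e} {N} TD≤cN ec≤D = *-cancelʳ-≤ (e * T) N D (begin
    e * T * D    ≡⟨ *-assoc e T D ⟩
    e * (T * D)  ≤⟨ *-monoʳ-≤ e TD≤cN ⟩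
    e * (c * N)  ≡⟨ *-assoc e c N ⟨
    e * c * N    ≤⟨ *-monoˡ-≤ N ec≤D ⟩
    D * N        ≡⟨ *-comm D N ⟩
    N * D        ∎)
    where open ≤-Reasoning

  m∣n⇒m^k∣n^k : ∀ {m n} k → m ∣ n → m ^ k ∣ n ^ k
  m∣n⇒m^k∣n^k zero    _   = ∣-refl
  m∣n⇒m^k∣n^k (suc k) m∣n = *-pres-∣ m∣n (m∣n⇒m^k∣n^k k m∣n)

  n≤2^n : ∀ n → n ≤ 2 ^ n
  n≤2^n zero    = z≤n
  n≤2^n (suc n) = ≤-trans (+-mono-≤ (m^n>0 2 n) (n≤2^n n)) (≤-reflexive (cong (2 ^ n +_) (sym (+-identityʳ (2 ^ n)))))

  -- Here q will be about √y / 2 and κ the integer part of the base 4 logarithm of z, while w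
  -- separates the small primes, which enter M to the power b, from those that enter it once. The
  -- value of b makes 2^b the fourth power of 4^(κ+1), as needed for `small-ok` below.
  module Multiplier (q κ w : ℕ) (4^κ≤z : 4 ^ κ ≤ 3 * q) where
    z b : ℕ
    z = 3 * q
    b = 8 * suc κ

    module G₁ = Primorial (primorial z)
    module G₂ = Primorial (primorial w)

    M : ℕ
    M = G₁.bound * G₂.bound ^ b

    M≢0 : NonZero M
    M≢0 = m*n≢0 _ _ {{G₁.bound≢0}} {{m^n≢0 _ b {{G₂.bound≢0}}}}

    M≤ : M ≤ 4 ^ (3 * q + w * b)
    M≤ = begin
      M                    ≤⟨ *-mono-≤ G₁.≤4^ (^-monoˡ-≤ b G₂.≤4^) ⟩
      4 ^ z * (4 ^ w) ^ b  ≡⟨ cong (4 ^ z *_) (^-*-assoc 4 w b) ⟩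
      4 ^ z * 4 ^ (w * b)  ≡⟨ ^-distribˡ-+-* 4 z (w * b) ⟨
      4 ^ (z + w * b)      ∎
      where open ≤-Reasoning

    1≤z : 1 ≤ z
    1≤z = ≤-trans (m^n>0 4 κ) 4^κ≤z

    module _ (n : ℕ) .{{_ : NonZero n}} where

      N : ℕ
      N = n * (n * M)

      -- Only the lengths of the intervals matter for the count, so they may be generous: the first
      -- is (1, w + 1] and the second (w, w + z].
      small medium large : List ℕ
      small  = map (_^ suc b) (interval 1 w)
      medium = map (_^ 3) (interval w z)
      large  = primeSquares z n

      -- Up to w the power p^b already divides M. For w < p ≤ z one factor p comes from M and a
      -- second one from n. Beyond z the only guaranteed factor is the one in n.
      cover : ∀ {p} → Prime p → p ∣ n →
              ∃ λ e → p ^ e ∣ n * M × p ^ suc e ∈ small ++ medium ++ large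
      cover {p} pp p∣n with p ≤? w | p ≤? z
      ... | yes p≤w | _ = b , ∣n⇒∣m*n n (∣n⇒∣m*n G₁.bound (m∣n⇒m^k∣n^k b (G₂.prime∣ pp p≤w)))
            , ∈-++⁺ˡ (∈-map⁺ (_^ suc b) (interval⁺ (nonTrivial⇒n>1 p {{prime⇒nonTrivial pp}}) (m≤n⇒m≤1+n p≤w)))
      ... | no p≰w | yes p≤z = 2 , *-pres-∣ p∣n (subst (_∣ M) (sym (*-identityʳ p)) (∣m⇒∣m*n (G₂.bound ^ b) (G₁.prime∣ pp p≤z)))
            , ∈-++⁺ʳ small (∈-++⁺ˡ (∈-map⁺ (_^ 3) (interval⁺ (≰⇒> p≰w) (≤-trans p≤z (m≤n+m z w)))))
      -- From p ≤ n ≤ 2^n ≤ z 2^n it follows that n dyadic blocks reach every prime divisor of n.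
      ... | no p≰w | no p≰z = 1 , ∣m⇒∣m*n M (subst (_∣ n) (sym (*-identityʳ p)) p∣n)
            , ∈-++⁺ʳ small (∈-++⁺ʳ medium (∈-primeSquares pp (≰⇒> p≰z) n
                (≤-trans (∣⇒≤ p∣n) (≤-trans (n≤2^n n) (m≤n*m (2 ^ n) z {{>-nonZero 1≤z}})))))

      T : ℕ
      T = sifted N (small ++ medium ++ large)

      sieved : N ≤ φ n * σ (n * M) + T
      sieved = sieve n (n * M) {{it}} {{m*n≢0 n M {{it}} {{M≢0}}}} (small ++ medium ++ large) cover
        where
        it : NonZero n
        it = >-nonZero (>-nonZero⁻¹ n)

      T₁ T₂ T₃ : ℕ
      T₁ = sifted N small
      T₂ = sifted N medium
      T₃ = sifted N large

      T≡ : T ≡ T₁ + (T₂ + T₃)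
      T≡ = trans (sifted-++ N small (medium ++ large)) (cong (T₁ +_) (sifted-++ N medium large))

      T₁≤ : T₁ * 2 ^ b ≤ w * N
      T₁≤ = subst (λ l → T₁ * 2 ^ b ≤ l * N) (length-applyUpTo _ w) (sifted-map-≤ (_^ suc b) (interval 1 w)
        λ {k} k∈ → ≤-trans (^-monoʳ-≤ 2 (n≤1+n b)) (^-monoˡ-≤ (suc b) (proj₁ (interval⁻ k∈))))

      T₂≤ : T₂ * w ^ 3 ≤ z * N
      T₂≤ = subst (λ l → T₂ * w ^ 3 ≤ l * N) (length-applyUpTo _ z) (sifted-map-≤ (_^ 3) (interval w z)
        λ {k} k∈ → ^-monoˡ-≤ 3 (<⇒≤ (proj₁ (interval⁻ k∈))))

      T₃≤ : κ * z * T₃ ≤ 2 * N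
      T₃≤ = sifted-primeSquares {N} {κ} {z} {{>-nonZero 1≤z}} 4^κ≤z n

      module _ (small-ok  : 24 * suc κ * suc q * w ≤ 2 ^ b)
               (medium-ok : 24 * suc κ * suc q * z ≤ w ^ 3)
               (1≤w  : 1 ≤ w) (17≤κ : 17 ≤ κ) (17≤q : 17 ≤ q) where

        17[1+_]≤18* : ∀ {m} → 17 ≤ m → 17 * suc m ≤ 18 * m
        17[1+_]≤18* {m} 17≤m = begin
          17 * suc m   ≡⟨ *-suc 17 m ⟩
          17 + 17 * m  ≤⟨ +-monoˡ-≤ (17 * m) 17≤m ⟩
          m + 17 * m   ∎
          where open ≤-Reasoning

        -- The bound `T₃≤` says 12 κ q T₃ ≤ 8 N. Replacing κ and q by their successors costs a
        -- factor of at most (18/17)², which is less than 9/8.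
        T₃≤′ : 12 * suc κ * suc q * T₃ ≤ 9 * N
        T₃≤′ = *-cancelˡ-≤ 289 (begin
          289 * (12 * suc κ * suc q * T₃)              ≡⟨ lemma₁ (suc κ) (suc q) T₃ ⟩
          12 * ((17 * suc κ) * (17 * suc q) * T₃)      ≤⟨ *-monoʳ-≤ 12 (*-monoˡ-≤ T₃ (*-mono-≤ (17[1+_]≤18* 17≤κ) (17[1+_]≤18* 17≤q))) ⟩
          12 * ((18 * κ) * (18 * q) * T₃)              ≡⟨ lemma₂ κ q T₃ ⟩
          1296 * (κ * (3 * q) * T₃)                    ≤⟨ *-monoʳ-≤ 1296 T₃≤ ⟩
          1296 * (2 * N)                               ≡⟨ *-assoc 1296 2 N ⟨
          2592 * N                                     ≤⟨ *-monoˡ-≤ N (≤ᵇ⇒≤ 2592 2601 tt) ⟩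
          2601 * N                                     ≡⟨ *-assoc 289 9 N ⟩
          289 * (9 * N)                                ∎)
          where
          open ≤-Reasoning
          lemma₁ : ∀ k r t → 289 * (12 * k * r * t) ≡ 12 * ((17 * k) * (17 * r) * t)
          lemma₁ = solve-∀
          lemma₂ : ∀ k r t → 12 * ((18 * k) * (18 * r) * t) ≡ 1296 * (k * (3 * r) * t)
          lemma₂ = solve-∀

        -- After multiplication by 24 (κ + 1) (q + 1), the small and the medium range take N each
        -- and the large one 18 N, which exhausts 20 N = 4 · 5 N.
        T≤ : 6 * suc κ * suc q * T ≤ 5 * N
        T≤ = *-cancelˡ-≤ 4 (begin
          4 * (6 * suc κ * suc q * T)                     ≡⟨ cong (λ t → 4 * (6 * suc κ * suc q * t)) T≡ ⟩
          4 * (6 * suc κ * suc q * (T₁ + (T₂ + T₃)))      ≡⟨ lemma₁ (suc κ) (suc q) T₁ T₂ T₃ ⟩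
          24 * suc κ * suc q * T₁ + (24 * suc κ * suc q * T₂ + 2 * (12 * suc κ * suc q * T₃))
            ≤⟨ +-mono-≤ (absorb {T₁} {2 ^ b} {w} {24 * suc κ * suc q} {N} {{m^n≢0 2 b}} T₁≤ small-ok)
              (+-mono-≤ (absorb {T₂} {w ^ 3} {z} {24 * suc κ * suc q} {N} {{m^n≢0 w 3 {{>-nonZero 1≤w}}}} T₂≤ medium-ok)
                (*-monoʳ-≤ 2 T₃≤′)) ⟩
          N + (N + 2 * (9 * N))                           ≡⟨ lemma₂ N ⟩
          4 * (5 * N)                                     ∎)
          where
          open ≤-Reasoning
          lemma₁ : ∀ k r t u v → 4 * (6 * k * r * (t + (u + v))) ≡ 24 * k * r * t + (24 * k * r * u + 2 * (12 * k * r * v))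
          lemma₁ = solve-∀
          lemma₂ : ∀ N → N + (N + 2 * (9 * N)) ≡ 4 * (5 * N)
          lemma₂ = solve-∀

        σ-bound : 6 * suc κ * suc q * N ≤ 6 * suc κ * suc q * (φ n * σ (n * M)) + 5 * N
        σ-bound = begin
          c * N                           ≤⟨ *-monoʳ-≤ c sieved ⟩
          c * (φ n * σ (n * M) + T)       ≡⟨ *-distribˡ-+ c (φ n * σ (n * M)) T ⟩
          c * (φ n * σ (n * M)) + c * T   ≤⟨ +-monoʳ-≤ (c * (φ n * σ (n * M))) T≤ ⟩
          c * (φ n * σ (n * M)) + 5 * N   ∎
          where
          open ≤-Reasoning
          c = 6 * suc κ * suc q

  ⌊log₄⌋ : ∀ z → 1 ≤ z → ∃ λ κ → 4 ^ κ ≤ z × z < 4 ^ suc κ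
  ⌊log₄⌋ (suc zero) _ = 0 , s≤s z≤n , s≤s (s≤s z≤n)
  ⌊log₄⌋ (suc z@(suc _)) _ with ⌊log₄⌋ z (s≤s z≤n)
  ... | κ , 4^κ≤z , z< with suc z <? 4 ^ suc κ
  ... | yes z+1< = κ , m≤n⇒m≤1+n 4^κ≤z , z+1<
  ... | no  z+1≮ = suc κ , ≮⇒≥ z+1≮ , ≤-<-trans z< (^-monoʳ-< 4 (s≤s (s≤s z≤n)) (n<1+n (suc κ)))

  -- The ratio is at most (4/3)⁴ = 256/81 < 4.
  [1+k]^4≤4*k^4 : ∀ {k} → 3 ≤ k → suc k ^ 4 ≤ 4 * k ^ 4
  [1+k]^4≤4*k^4 {k} 3≤k = *-cancelˡ-≤ 81 (begin
    81 * suc k ^ 4     ≡⟨ lemma₁ (suc k) ⟩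
    (3 * suc k) ^ 4    ≤⟨ ^-monoˡ-≤ 4 (≤-trans (≤-reflexive (*-suc 3 k)) (+-monoˡ-≤ (3 * k) 3≤k)) ⟩
    (4 * k) ^ 4        ≡⟨ lemma₂ k ⟩
    256 * k ^ 4        ≤⟨ *-monoˡ-≤ (k ^ 4) (≤ᵇ⇒≤ 256 324 tt) ⟩
    324 * k ^ 4        ≡⟨ *-assoc 81 4 (k ^ 4) ⟩
    81 * (4 * k ^ 4)   ∎)
    where
    open ≤-Reasoning
    lemma₁ : ∀ k → 81 * (k * (k * (k * (k * 1)))) ≡ (3 * k) * ((3 * k) * ((3 * k) * ((3 * k) * 1)))
    lemma₁ = solve-∀
    lemma₂ : ∀ k → (4 * k) * ((4 * k) * ((4 * k) * ((4 * k) * 1))) ≡ 256 * (k * (k * (k * (k * 1))))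
    lemma₂ = solve-∀

  -- The fourth power arises because w has to exceed a constant times (κ + 1)³, while w itself is
  -- about q / (9 (κ + 1)).
  4^-dominates : ∀ {c κ₀} → 2 ≤ κ₀ → c * suc κ₀ ^ 4 ≤ 4 ^ κ₀ → ∀ {κ} → κ₀ ≤′ κ → c * suc κ ^ 4 ≤ 4 ^ κ
  4^-dominates _ base ≤′-refl = base
  4^-dominates {c} 2≤κ₀ base (≤′-step {n = κ} κ₀≤κ) = begin
    c * suc (suc κ) ^ 4     ≤⟨ *-monoʳ-≤ c ([1+k]^4≤4*k^4 (s≤s (≤-trans 2≤κ₀ (≤′⇒≤ κ₀≤κ)))) ⟩
    c * (4 * suc κ ^ 4)     ≡⟨ lemma c (suc κ ^ 4) ⟩
    4 * (c * suc κ ^ 4)     ≤⟨ *-monoʳ-≤ 4 (4^-dominates {c} 2≤κ₀ base κ₀≤κ) ⟩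
    4 ^ suc κ               ∎
    where
    open ≤-Reasoning
    lemma : ∀ c x → c * (4 * x) ≡ 4 * (c * x)
    lemma = solve-∀

  -- M multiplies the abundancy index of every n up to n / φ n, save for a factor
  -- 1 - 5 / (6 k (q + 1)), where k is of the order of log q.
  record IsMultiplier (q k M : ℕ) : Set where
    field
      k≢0    : NonZero k
      M≢0    : NonZero M
      M<16^  : M < 16 ^ (2 * q)
      2q+2≤  : 2 * suc q ≤ 4 ^ k
      σ≥     : ∀ n → .{{NonZero n}} →
               6 * k * suc q * (n * (n * M)) ≤ 6 * k * suc q * (φ n * σ (n * M)) + 5 * (n * (n * M))

  -- The value of `c` is 24 · 18 · 3 · 18, which appears in `medium-ok` when q is replaced by 18 k w
  -- twice. The factor 27 is 3 · 9, from 4^κ ≤ 3 q and the divisor 9 k in w. Tied to its value by an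
  -- equation, `c` stays symbolic in the calculations.
  multiplier : ∀ {c κ₀} → c ≡ 23328 → 17 ≤ κ₀ → c * 27 * suc κ₀ ^ 4 ≤ 4 ^ κ₀ →
    ∀ q → 4 ^ κ₀ ≤ q → ∃₂ (IsMultiplier q)
  multiplier {c} {κ₀} c≡ 17≤κ₀ base q 4^κ₀≤q = suc κ , Mul.M , record
    { k≢0 = _ ; M≢0 = Mul.M≢0 ; M<16^ = M<16^ ; 2q+2≤ = ≤-trans 2q+2≤3q (<⇒≤ 3q<4^k)
    ; σ≥ = λ n → Mul.σ-bound n small-ok medium-ok 1≤w (≤-trans 17≤κ₀ κ₀≤κ) 17≤q }
    where
    open ≤-Reasoning
    1≤q : 1 ≤ q
    1≤q = ≤-trans (m^n>0 4 κ₀) 4^κ₀≤q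
    17≤q : 17 ≤ q
    17≤q = ≤-trans 17≤κ₀ (≤-trans (n≤2^n κ₀) (≤-trans (^-monoˡ-≤ κ₀ (≤ᵇ⇒≤ 2 4 tt)) 4^κ₀≤q))
    log = ⌊log₄⌋ (3 * q) (≤-trans 1≤q (m≤n*m q 3))
    κ = proj₁ log
    k = suc κ
    4^κ≤3q : 4 ^ κ ≤ 3 * q
    4^κ≤3q = proj₁ (proj₂ log)
    3q<4^k : 3 * q < 4 ^ k
    3q<4^k = proj₂ (proj₂ log)
    κ₀≤κ : κ₀ ≤ κ
    κ₀≤κ = ≮⇒≥ λ κ<κ₀ → ≤⇒≯ (≤-trans 4^κ₀≤q (m≤n*m q 3)) (<-≤-trans 3q<4^k (^-monoʳ-≤ 4 κ<κ₀))
    -- The second factor of M is at most 4^(8 k w), and 4^q is left for it. Dividing by 9 k instead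
    -- of 8 k makes the inequality 8 k w < q strict.
    w = q / (9 * k)
    module Mul = Multiplier q κ w 4^κ≤3q

    w*9k≤q : w * (9 * k) ≤ q
    w*9k≤q = m/n*n≤m q (9 * k)
    ck³≤w : c * k ^ 3 ≤ w
    ck³≤w = subst (_≤ w) (m*n/n≡m (c * k ^ 3) (9 * k)) (/-monoˡ-≤ {c * k ^ 3 * (9 * k)} {q} (9 * k) (*-cancelˡ-≤ 3 (begin
      3 * (c * k ^ 3 * (9 * k))  ≡⟨ lemma₁ c k ⟩
      c * 27 * k ^ 4                 ≤⟨ 4^-dominates {c * 27} {κ₀} (≤-trans (≤ᵇ⇒≤ 2 17 tt) 17≤κ₀) base (≤⇒≤′ κ₀≤κ) ⟩
      4 ^ κ                          ≤⟨ 4^κ≤3q ⟩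
      3 * q                          ∎)))
      where
      lemma₁ : ∀ c k → 3 * (c * (k * (k * (k * 1))) * (9 * k)) ≡ c * 27 * (k * (k * (k * (k * 1))))
      lemma₁ = solve-∀
    1≤w : 1 ≤ w
    1≤w = ≤-trans (*-mono-≤ (subst (1 ≤_) (sym c≡) (≤ᵇ⇒≤ 1 23328 tt)) (m^n>0 k 3)) ck³≤w
    w≤q : w ≤ q
    w≤q = m/n≤m q (9 * k)
    q<18kw : q < 18 * k * w
    q<18kw = begin-strict
      q                         ≡⟨ m≡m%n+[m/n]*n q (9 * k) ⟩
      q % (9 * k) + w * (9 * k) <⟨ +-monoˡ-< (w * (9 * k)) (m%n<n q (9 * k)) ⟩
      9 * k + w * (9 * k)       ≤⟨ +-monoˡ-≤ (w * (9 * k)) (m≤n*m (9 * k) w {{>-nonZero 1≤w}}) ⟩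
      w * (9 * k) + w * (9 * k) ≡⟨ lemma₁ k w ⟩
      18 * k * w                ∎
      where
      lemma₁ : ∀ k w → w * (9 * k) + w * (9 * k) ≡ 18 * k * w
      lemma₁ = solve-∀

    2q+2≤3q : 2 * suc q ≤ 3 * q
    2q+2≤3q = begin
      2 * suc q  ≡⟨ *-suc 2 q ⟩
      2 + 2 * q  ≤⟨ +-monoˡ-≤ (2 * q) (≤-trans (≤ᵇ⇒≤ 2 17 tt) 17≤q) ⟩
      3 * q      ∎
    1+q≤4^k : suc q ≤ 4 ^ k
    1+q≤4^k = ≤-trans (≤-trans (m≤n*m (suc q) 2) 2q+2≤3q) (<⇒≤ 3q<4^k)
    24≤4^k : 24 ≤ 4 ^ k
    24≤4^k = ≤-trans (≤ᵇ⇒≤ 24 (4 ^ 3) tt) (^-monoʳ-≤ 4 (≤-trans (≤ᵇ⇒≤ 3 18 tt) (s≤s (≤-trans 17≤κ₀ κ₀≤κ))))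
    k≤4^k : k ≤ 4 ^ k
    k≤4^k = ≤-trans (n≤2^n k) (^-monoˡ-≤ k (≤ᵇ⇒≤ 2 4 tt))

    -- Each of the four factors 24, k, q + 1 and w is at most 4^k, and the fourth power of 4^k is
    -- 2^(8 k).
    small-ok : 24 * suc κ * suc q * w ≤ 2 ^ (8 * suc κ)
    small-ok = begin
      24 * k * suc q * w               ≤⟨ *-mono-≤ (*-mono-≤ (*-mono-≤ 24≤4^k k≤4^k) 1+q≤4^k)
                                            (≤-trans w≤q (≤-trans (n≤1+n q) 1+q≤4^k)) ⟩
      4 ^ k * 4 ^ k * 4 ^ k * 4 ^ k    ≡⟨ lemma₁ (4 ^ k) ⟩
      (4 ^ k) ^ 4                      ≡⟨ ^-*-assoc 4 k 4 ⟩
      4 ^ (k * 4)                      ≡⟨ ^-*-assoc 2 2 (k * 4) ⟩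
      2 ^ (2 * (k * 4))                ≡⟨ cong (2 ^_) (lemma₂ k) ⟩
      2 ^ (8 * k)                      ∎
      where
      lemma₁ : ∀ x → x * x * x * x ≡ x * (x * (x * (x * 1)))
      lemma₁ = solve-∀
      lemma₂ : ∀ k → 2 * (k * 4) ≡ 8 * k
      lemma₂ = solve-∀

    medium-ok : 24 * suc κ * suc q * (3 * q) ≤ w ^ 3
    medium-ok = begin
      24 * k * suc q * (3 * q)                 ≤⟨ *-mono-≤ (*-monoʳ-≤ (24 * k) q<18kw) (*-monoʳ-≤ 3 (<⇒≤ q<18kw)) ⟩
      24 * k * (18 * k * w) * (3 * (18 * k * w)) ≡⟨ trans (lemma₁ k w) (cong (λ x → x * k ^ 3 * (w * w)) {23328} {c} (sym c≡)) ⟩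
      c * k ^ 3 * (w * w)                      ≤⟨ *-monoˡ-≤ (w * w) ck³≤w ⟩
      w * (w * w)                              ≡⟨ cong (λ x → w * (w * x)) (*-identityʳ w) ⟨
      w ^ 3                                    ∎
      where
      lemma₁ : ∀ k w → 24 * k * (18 * k * w) * (3 * (18 * k * w)) ≡ 23328 * (k * (k * (k * 1))) * (w * w)
      lemma₁ = solve-∀

    M<16^ : Mul.M < 16 ^ (2 * q)
    M<16^ = begin-strict
      Mul.M                      ≤⟨ Mul.M≤ ⟩
      4 ^ (3 * q + w * (8 * k))  <⟨ ^-monoʳ-< 4 (s≤s (s≤s z≤n)) (+-monoʳ-< (3 * q) w*8k<q) ⟩
      4 ^ (3 * q + q)            ≡⟨ cong (4 ^_) (lemma₁ q) ⟩
      4 ^ (2 * (2 * q))          ≡⟨ ^-*-assoc 4 2 (2 * q) ⟨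
      16 ^ (2 * q)               ∎
      where
      lemma₁ : ∀ q → 3 * q + q ≡ 2 * (2 * q)
      lemma₁ = solve-∀
      w*8k<q : w * (8 * k) < q
      w*8k<q = <-≤-trans (*-monoʳ-< w {{>-nonZero 1≤w}} (*-monoˡ-< k (n<1+n 8))) w*9k≤q


  abstract
    -- For κ₀ = 20 the base inequality compares about 1.2 · 10¹¹ with about 1.1 · 10¹². The
    -- threshold 4^20 is hidden, since its size is irrelevant from here on.
    multiplier-eventually : ∃ λ Q → ∀ q → Q ≤ q → ∃₂ (IsMultiplier q)
    multiplier-eventually = 4 ^ 20 , multiplier {23328} {20} refl (≤ᵇ⇒≤ 17 20 tt) (≤ᵇ⇒≤ (23328 * 27 * 21 ^ 4) (4 ^ 20) tt)

  -- Unbounded abundancy through harmonic sums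

  σ-upTo : ℕ → ℕ → ℕ
  σ-upTo m a = sum (filter (_∣? m) [1… a ])

  σ-upTo-suc : ∀ m a → σ-upTo m (suc a) ≡ σ-upTo m a + sum (filter (_∣? m) (suc a ∷ []))
  σ-upTo-suc m a = begin
    sum (filter (_∣? m) [1… suc a ])                                       ≡⟨ cong (sum ∘ filter (_∣? m)) (applyUpTo-∷ʳ suc a) ⟨
    sum (filter (_∣? m) ([1… a ] ++ suc a ∷ []))                           ≡⟨ cong sum (filter-++ (_∣? m) [1… a ] _) ⟩
    sum (filter (_∣? m) [1… a ] ++ filter (_∣? m) (suc a ∷ []))            ≡⟨ sum-++ (filter (_∣? m) [1… a ]) _ ⟩
    σ-upTo m a + sum (filter (_∣? m) (suc a ∷ []))                         ∎
    where open ≡-Reasoning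

  σ-upTo-mono : ∀ m {a b} → a ≤ b → σ-upTo m a ≤ σ-upTo m b
  σ-upTo-mono m {b = b} a≤b with ≤⇒≤′ a≤b
  ... | ≤′-refl     = ≤-refl
  ... | ≤′-step {n = c} a≤′c = ≤-trans (σ-upTo-mono m (≤′⇒≤ a≤′c))
    (≤-trans (m≤m+n _ _) (≤-reflexive (sym (σ-upTo-suc m c))))

  σ-upTo-divisor : ∀ {m d} → suc d ∣ m → σ-upTo m (suc d) ≡ σ-upTo m d + suc d
  σ-upTo-divisor {m} {d} d∣m = trans (σ-upTo-suc m d) (cong (σ-upTo m d +_)
    (trans (cong sum (filter-accept (_∣? m) d∣m)) (+-identityʳ (suc d))))

  -- σ restricted to the divisors m / k with k ≤ K, so that h K stands for m times
  -- the K-th harmonic number.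
  module Harmonic (m : ℕ) .{{_ : NonZero m}} where

    h : ℕ → ℕ
    h zero    = 0
    h (suc K) = h K + m / suc K

    -- The divisors m / 1 > m / 2 > ... > m / K are distinct. The summand `σ-upTo` holds the
    -- divisors below m / K, so that each step of the induction takes one divisor out of it.
    h≤σ : ∀ K → .{{_ : NonZero K}} → (∀ {k} → 1 ≤ k → k ≤ K → k ∣ m) →
          h K + σ-upTo m (pred (m / K)) ≤ σ m
    h≤σ 1 _ = ≤-reflexive (trans (cong (λ x → x + σ-upTo m (pred x)) (n/1≡n m)) (lemma m))
      where
      lemma : ∀ m → .{{NonZero m}} → m + σ-upTo m (pred m) ≡ σ m
      lemma (suc m) = trans (+-comm (suc m) _) (sym (σ-upTo-divisor {suc m} ∣-refl))
    h≤σ (suc K@(suc _)) K!∣m = begin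
      h K + m / suc K + σ-upTo m (pred (m / suc K))
        ≡⟨ +-assoc (h K) (m / suc K) _ ⟩
      h K + (m / suc K + σ-upTo m (pred (m / suc K)))
        ≡⟨ cong (h K +_) (step (m / suc K) refl) ⟩
      h K + σ-upTo m (m / suc K)
        ≤⟨ +-monoʳ-≤ (h K) (σ-upTo-mono m (≤-pred′ decreasing)) ⟩
      h K + σ-upTo m (pred (m / K))
        ≤⟨ h≤σ K (λ 1≤k k≤K → K!∣m 1≤k (m≤n⇒m≤1+n k≤K)) ⟩
      σ m ∎
      where
      open ≤-Reasoning
      m≡ : suc K * (m / suc K) ≡ m
      m≡ = m*[n/m]≡n (K!∣m (s≤s z≤n) ≤-refl)
      m≡′ : K * (m / K) ≡ m
      m≡′ = m*[n/m]≡n (K!∣m (s≤s z≤n) (n≤1+n K))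
      quotient≢0′ : NonZero (m / suc K)
      quotient≢0′ = m*n≢0⇒n≢0 (suc K) {{subst NonZero (sym m≡) (>-nonZero (>-nonZero⁻¹ m))}}
      step : ∀ d → d ≡ m / suc K → d + σ-upTo m (pred d) ≡ σ-upTo m d
      step zero    _  = refl
      step (suc d) eq = trans (+-comm (suc d) _) (sym (σ-upTo-divisor
        (subst (_∣ m) (sym eq) (divides (suc K) (sym m≡)))))
      decreasing : m / suc K < m / K
      decreasing = *-cancelˡ-< K _ _ (begin-strict
        K * (m / suc K)      <⟨ *-monoˡ-< (m / suc K) {{quotient≢0′}} (n<1+n K) ⟩
        suc K * (m / suc K)  ≡⟨ trans m≡ (sym m≡′) ⟩
        K * (m / K)          ∎)
      ≤-pred′ : ∀ {x y} → x < y → x ≤ pred y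
      ≤-pred′ (s≤s x≤y) = x≤y

    -- Each of the j new terms m / i has i ≤ A and is therefore at least m / A.
    h-+ : ∀ {A} J j → J + j ≤ A → (∀ {k} → 1 ≤ k → k ≤ J + j → k ∣ m) →
          j * m + A * h J ≤ A * h (J + j)
    h-+ {A} J zero    _  _   = ≤-reflexive (cong (λ x → A * h x) (sym (+-identityʳ J)))
    h-+ {A} J (suc j) ≤A k∣m = begin
      m + j * m + A * h J                             ≡⟨ +-assoc m (j * m) (A * h J) ⟩
      m + (j * m + A * h J)                           ≤⟨ +-mono-≤ m≤ (h-+ J j (≤-trans (n≤1+n (J + j)) ≤A′)
                                                          λ 1≤k k≤ → k∣m 1≤k (≤-trans (m≤n⇒m≤1+n k≤) (≤-reflexive (sym (+-suc J j))))) ⟩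
      A * (m / suc (J + j)) + A * h (J + j)           ≡⟨ *-distribˡ-+ A _ (h (J + j)) ⟨
      A * (m / suc (J + j) + h (J + j))               ≡⟨ cong (A *_) (+-comm (m / suc (J + j)) (h (J + j))) ⟩
      A * h (suc (J + j))                             ≡⟨ cong (λ x → A * h x) (+-suc J j) ⟨
      A * h (J + suc j)                               ∎
      where
      open ≤-Reasoning
      ≤A′ : suc (J + j) ≤ A
      ≤A′ = subst (_≤ A) (+-suc J j) ≤A
      m≤ : m ≤ A * (m / suc (J + j))
      m≤ = begin
        m                                  ≡⟨ m*[n/m]≡n (k∣m {suc (J + j)} (s≤s z≤n) (≤-reflexive (sym (+-suc J j)))) ⟨
        suc (J + j) * (m / suc (J + j))    ≤⟨ *-monoˡ-≤ (m / suc (J + j)) ≤A′ ⟩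
        A * (m / suc (J + j))              ∎

    -- Oresme's grouping: the terms with index in (2^i, 2^(i+1)] add up to at least m / 2.
    h-2^ : ∀ i → (∀ {k} → 1 ≤ k → k ≤ 2 ^ i → k ∣ m) → i * m ≤ 2 * h (2 ^ i)
    h-2^ zero    _   = z≤n
    h-2^ (suc i) k∣m = *-cancelˡ-≤ I {{m^n≢0 2 i}} (begin
      I * (m + i * m)                ≤⟨ *-monoʳ-≤ I (+-monoʳ-≤ m (h-2^ i (λ 1≤k k≤ → k∣m 1≤k (≤-trans k≤ (m≤m+n I _))))) ⟩
      I * (m + 2 * h I)              ≡⟨ lemma₁ I m (h I) ⟩
      I * m + (I + I) * h I          ≤⟨ h-+ {I + I} I I ≤-refl (λ {k} 1≤k k≤ → k∣m 1≤k (subst (k ≤_) I+I k≤)) ⟩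
      (I + I) * h (I + I)            ≡⟨ lemma₂ I (h (I + I)) ⟩
      I * (2 * h (I + I))            ≡⟨ cong (λ x → I * (2 * h x)) I+I ⟩
      I * (2 * h (2 ^ suc i))        ∎)
      where
      open ≤-Reasoning
      I = 2 ^ i
      I+I : I + I ≡ 2 ^ suc i
      I+I = cong (I +_) (sym (+-identityʳ I))
      lemma₁ : ∀ I m x → I * (m + 2 * x) ≡ I * m + (I + I) * x
      lemma₁ = solve-∀
      lemma₂ : ∀ I x → (I + I) * x ≡ I * (2 * x)
      lemma₂ = solve-∀

  -- All k up to K = 2^(2j) divide n K!, so σ (n K!) is at least n K! times the K-th harmonic
  -- number. The multiplier does not depend on n; this uniformity yields the positivity of A.
  abundant : ∀ j → ∃ λ m → NonZero m × (∀ n → .{{NonZero n}} → j * (n * m) ≤ σ (n * m))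
  abundant j = K ! , (K !≢0) , bound
    where
    open ≤-Reasoning
    K = 2 ^ (2 * j)
    bound : ∀ n → .{{NonZero n}} → j * (n * K !) ≤ σ (n * K !)
    bound n = begin
      j * m  ≤⟨ *-cancelˡ-≤ 2 (≤-trans (≤-reflexive (sym (*-assoc 2 j m))) (H.h-2^ (2 * j) k∣m)) ⟩
      H.h K  ≤⟨ m≤m+n (H.h K) _ ⟩
      H.h K + σ-upTo m (pred ((m / K) {{m^n≢0 2 (2 * j)}}))  ≤⟨ H.h≤σ K {{m^n≢0 2 (2 * j)}} k∣m ⟩
      σ m ∎
      where
      m = n * K !
      module H = Harmonic m {{m*n≢0 n (K !) {{>-nonZero (>-nonZero⁻¹ n)}} {{K !≢0}}}}
      k∣m : ∀ {k} → 1 ≤ k → k ≤ K → k ∣ m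
      k∣m {suc k} _ k≤K = ∣n⇒∣m*n n (∣-trans (m∣m*n (k !)) (m≤n⇒m!∣n! k≤K))

  -- Auxiliary facts for densities

  length-filter-* : ∀ {p q} {P : Pred ℕ p} {Q : Pred ℕ q} (P? : Decidable P) (Q? : Decidable Q) m → .{{NonZero m}} →
    (∀ n → .{{NonZero n}} → P n → Q (n * m)) → ∀ N →
    length (filter P? [1… N ]) ≤ length (filter Q? [1… N * m ])
  length-filter-* {P = P} {Q} P? Q? m P⇒Q N = begin
    length (filter P? [1… N ])               ≡⟨ length-map (_* m) (filter P? [1… N ]) ⟨
    length (map (_* m) (filter P? [1… N ]))  ≤⟨ ⊆⇒length≤ (Unique.map⁺ (*-cancelʳ-≡ _ _ m) (Unique.filter⁺ P? (range-unique N))) sub ⟩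
    length (filter Q? [1… N * m ])           ∎
    where
    open ≤-Reasoning
    sub : map (_* m) (filter P? [1… N ]) ⊆ filter Q? [1… N * m ]
    sub x∈ with ∈-map⁻ (_* m) x∈
    ... | n , n∈ , refl with ∈-filter⁻ P? {xs = [1… N ]} n∈
    ... | n∈r , Pn = let 1≤n , n≤N = range⁻ n∈r in
      ∈-filter⁺ Q? (range⁺ (*-mono-≤ 1≤n (>-nonZero⁻¹ m)) (*-monoˡ-≤ m n≤N)) (P⇒Q n {{>-nonZero 1≤n}} Pn)

  φ≢0 : ∀ n → .{{NonZero n}} → NonZero (φ n)
  φ≢0 n = >-nonZero (∈-length (∈-filter⁺ (λ k → coprime? k n) (range⁺ ≤-refl (>-nonZero⁻¹ n)) (λ {i} → 1-coprimeTo n {i})))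

module RealAnalysis (em : ExcludedMiddle 0ℓ) (ℝ : CompleteOrderedField) where

  open CompleteOrderedField ℝ
  open Analysis em ℝ
  open Arithmetic

  open import Algebra.Bundles using (RawRing; Semiring)
  open import Algebra.Definitions.RawSemiring (Semiring.rawSemiring semiring) using (_^_)
  open import Algebra.Properties.AbelianGroup +-abelianGroup using (⁻¹-∙-comm; ⁻¹-anti-homo‿-; ε⁻¹≈ε)
  open import Algebra.Properties.Ring ring using (x[y-z]≈xy-xz; [y-z]x≈yx-zx; x∙y⁻¹≈ε⇒x≈y; x≈y⇒x∙y⁻¹≈ε)
  open import Algebra.Properties.Semiring.Exp semiring using (^-congˡ)
  open import Algebra.Properties.Semiring.Mult semiring using (×-homo-+; ×1-homo-*)
  import Algebra.Solver.Ring as RingSolver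
  open import Algebra.Solver.Ring.AlmostCommutativeRing using (fromCommutativeRing; _-Raw-AlmostCommutative⟶_)
  import Algebra.Solver.Ring.NaturalCoefficients.Default as NatSolver
  open import Data.Empty using (⊥-elim)
  open import Data.List.Base using (filter; length)
  open import Data.List.Properties using (filter-all; length-applyUpTo)
  open import Data.List.Relation.Unary.All using (tabulate)
  open import Data.Maybe.Base using (Maybe; just; nothing)
  open import Data.Nat.Base as ℕ using (ℕ; zero; suc)
  import Data.Nat.Properties as ℕ
  open import Data.Sum.Base using (inj₁; inj₂)
  open import Function.Base using (_∘_; const)
  open import Relation.Binary.Bundles using (Poset)
  import Relation.Binary.Construct.NonStrictToStrict _≈_ _≤_ as Strict
  import Relation.Binary.Reasoning.Setoid setoid as ≈-Reasoning
  open import Relation.Binary.Structures using (IsTotalOrder)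

  module ≤ = IsTotalOrder isTotalOrder

  poset : Poset 0ℓ 0ℓ 0ℓ
  poset = record { isPartialOrder = ≤.isPartialOrder }

  import Relation.Binary.Reasoning.PartialOrder poset as ≤-Reasoning

  -- Natural numbers in the field, and a ring solver

  fromℕ-+ : ∀ m n → fromℕ (m ℕ.+ n) ≈ fromℕ m + fromℕ n
  fromℕ-+ = ×-homo-+ 1#

  fromℕ-* : ∀ m n → fromℕ (m ℕ.* n) ≈ fromℕ m * fromℕ n
  fromℕ-* = ×1-homo-*

  fromℕ-1 : fromℕ 1 ≈ 1#
  fromℕ-1 = +-identityʳ 1#

  -- A ring solver whose coefficients are integers, represented by differences of
  -- natural numbers, so that subtractions cancel without a zero test in ℝ.
  module IntegerCoefficients where
    open NatSolver commutativeSemiring using (solve; _:+_; _:*_; _:=_)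
    open ≈-Reasoning

    -- The clauses with second component 0 let the constants of solved equations evaluate to `1#`
    -- and `fromℕ a` themselves instead of to differences.
    difference : ℕ × ℕ → Carrier
    difference (1 , 0) = 1#
    difference (a , 0) = fromℕ a
    difference (a , b) = fromℕ a - fromℕ b

    difference≈ : ∀ a b → difference (a , b) ≈ fromℕ a - fromℕ b
    difference≈ 0             0       = sym (-‿inverseʳ 0#)
    difference≈ 1             0       = sym (trans (+-cong fromℕ-1 ε⁻¹≈ε) (+-identityʳ 1#))
    difference≈ (suc (suc a)) 0       = sym (trans (+-congˡ ε⁻¹≈ε) (+-identityʳ _))
    difference≈ 0             (suc b) = refl
    difference≈ 1             (suc b) = refl
    difference≈ (suc (suc a)) (suc b) = refl

    -‿+-interchange : ∀ a b c d → (a - b) + (c - d) ≈ (a + c) - (b + d)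
    -‿+-interchange a b c d = trans
      (solve 4 (λ a -b c -d → (a :+ -b) :+ (c :+ -d) := (a :+ c) :+ (-b :+ -d)) refl a (- b) c (- d))
      (+-congˡ (⁻¹-∙-comm b d))

    -‿*-interchange : ∀ a b c d → (a - b) * (c - d) ≈ (a * c + b * d) - (a * d + b * c)
    -‿*-interchange a b c d = begin
      (a - b) * (c - d)                      ≈⟨ [y-z]x≈yx-zx (c - d) a b ⟩
      a * (c - d) - b * (c - d)              ≈⟨ +-cong (x[y-z]≈xy-xz a c d) (-‿cong (x[y-z]≈xy-xz b c d)) ⟩
      (a * c - a * d) - (b * c - b * d)      ≈⟨ +-congˡ (⁻¹-anti-homo‿- (b * c) (b * d)) ⟩
      (a * c - a * d) + (b * d - b * c)      ≈⟨ -‿+-interchange (a * c) (a * d) (b * d) (b * c) ⟩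
      (a * c + b * d) - (a * d + b * c)      ∎

    difference-cong : ∀ a b c d → a ℕ.+ d ≡ c ℕ.+ b → difference (a , b) ≈ difference (c , d)
    difference-cong a b c d eq = begin
      difference (a , b)                   ≈⟨ difference≈ a b ⟩
      fromℕ a - fromℕ b                    ≈⟨ x∙y⁻¹≈ε⇒x≈y _ _ (begin
        (fromℕ a - fromℕ b) - (fromℕ c - fromℕ d)    ≈⟨ +-congˡ (⁻¹-anti-homo‿- (fromℕ c) (fromℕ d)) ⟩
        (fromℕ a - fromℕ b) + (fromℕ d - fromℕ c)    ≈⟨ -‿+-interchange (fromℕ a) (fromℕ b) (fromℕ d) (fromℕ c) ⟩
        (fromℕ a + fromℕ d) - (fromℕ b + fromℕ c)    ≈⟨ x≈y⇒x∙y⁻¹≈ε (begin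
          fromℕ a + fromℕ d    ≈⟨ fromℕ-+ a d ⟨
          fromℕ (a ℕ.+ d)      ≡⟨ ≡.cong fromℕ eq ⟩
          fromℕ (c ℕ.+ b)      ≈⟨ fromℕ-+ c b ⟩
          fromℕ c + fromℕ b    ≈⟨ +-comm (fromℕ c) (fromℕ b) ⟩
          fromℕ b + fromℕ c    ∎) ⟩
        0# ∎) ⟩
      fromℕ c - fromℕ d                    ≈⟨ difference≈ c d ⟨
      difference (c , d)                   ∎

    reduce : ℕ × ℕ → ℕ × ℕ
    reduce (a , b) = a ℕ.∸ b , b ℕ.∸ a

    reduce≈ : ∀ a b → difference (reduce (a , b)) ≈ fromℕ a - fromℕ b
    reduce≈ a b = trans (difference-cong (a ℕ.∸ b) (b ℕ.∸ a) a b (cross a b)) (difference≈ a b)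
      where
      cross : ∀ a b → a ℕ.∸ b ℕ.+ b ≡ a ℕ.+ (b ℕ.∸ a)
      cross zero    zero    = ≡.refl
      cross zero    (suc b) = ≡.refl
      cross (suc a) zero    = ≡.refl
      cross (suc a) (suc b) = ≡.trans (ℕ.+-suc (a ℕ.∸ b) b) (≡.cong suc (cross a b))

    coefficients : RawRing 0ℓ 0ℓ
    coefficients = record
      { Carrier = ℕ × ℕ
      ; _≈_     = _≡_
      ; _+_     = λ (a , b) (c , d) → reduce (a ℕ.+ c , b ℕ.+ d)
      ; _*_     = λ (a , b) (c , d) → reduce (a ℕ.* c ℕ.+ b ℕ.* d , a ℕ.* d ℕ.+ b ℕ.* c)
      ; -_      = λ (a , b) → b , a
      ; 0#      = 0 , 0
      ; 1#      = 1 , 0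
      }

    fromℕ-*+* : ∀ a b c d → fromℕ (a ℕ.* b ℕ.+ c ℕ.* d) ≈ fromℕ a * fromℕ b + fromℕ c * fromℕ d
    fromℕ-*+* a b c d = trans (fromℕ-+ (a ℕ.* b) (c ℕ.* d)) (+-cong (fromℕ-* a b) (fromℕ-* c d))

    morphism : coefficients -Raw-AlmostCommutative⟶ fromCommutativeRing commutativeRing
    morphism = record
      { ⟦_⟧    = difference
      ; +-homo = λ (a , b) (c , d) → begin
          difference (reduce (a ℕ.+ c , b ℕ.+ d))        ≈⟨ reduce≈ (a ℕ.+ c) (b ℕ.+ d) ⟩
          fromℕ (a ℕ.+ c) - fromℕ (b ℕ.+ d)              ≈⟨ +-cong (fromℕ-+ a c) (-‿cong (fromℕ-+ b d)) ⟩
          (fromℕ a + fromℕ c) - (fromℕ b + fromℕ d)      ≈⟨ -‿+-interchange (fromℕ a) (fromℕ b) (fromℕ c) (fromℕ d) ⟨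
          (fromℕ a - fromℕ b) + (fromℕ c - fromℕ d)      ≈⟨ +-cong (difference≈ a b) (difference≈ c d) ⟨
          difference (a , b) + difference (c , d)        ∎
      ; *-homo = λ (a , b) (c , d) → begin
          difference (reduce (a ℕ.* c ℕ.+ b ℕ.* d , a ℕ.* d ℕ.+ b ℕ.* c))
            ≈⟨ reduce≈ (a ℕ.* c ℕ.+ b ℕ.* d) (a ℕ.* d ℕ.+ b ℕ.* c) ⟩
          fromℕ (a ℕ.* c ℕ.+ b ℕ.* d) - fromℕ (a ℕ.* d ℕ.+ b ℕ.* c)
            ≈⟨ +-cong (fromℕ-*+* a c b d) (-‿cong (fromℕ-*+* a d b c)) ⟩
          (fromℕ a * fromℕ c + fromℕ b * fromℕ d) - (fromℕ a * fromℕ d + fromℕ b * fromℕ c)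
            ≈⟨ -‿*-interchange (fromℕ a) (fromℕ b) (fromℕ c) (fromℕ d) ⟨
          (fromℕ a - fromℕ b) * (fromℕ c - fromℕ d)
            ≈⟨ *-cong (difference≈ a b) (difference≈ c d) ⟨
          difference (a , b) * difference (c , d) ∎
      ; -‿homo = λ (a , b) → begin
          difference (b , a)       ≈⟨ difference≈ b a ⟩
          fromℕ b - fromℕ a        ≈⟨ ⁻¹-anti-homo‿- (fromℕ a) (fromℕ b) ⟨
          - (fromℕ a - fromℕ b)    ≈⟨ -‿cong (difference≈ a b) ⟨
          - difference (a , b)     ∎
      ; 0-homo = refl
      ; 1-homo = refl
      }

    difference-≟ : (x y : ℕ × ℕ) → Maybe (difference x ≈ difference y)
    difference-≟ (a , b) (c , d) with a ℕ.+ d ℕ.≟ c ℕ.+ b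
    ... | no  _  = nothing
    ... | yes eq = just (difference-cong a b c d eq)

  open IntegerCoefficients using (coefficients; morphism; difference-≟)
  open RingSolver coefficients (fromCommutativeRing commutativeRing) morphism difference-≟
    using (Polynomial; solve; con; _:=_; _:+_; _:*_; _:-_; :-_)

  :0 :1 : ∀ {n} → Polynomial n
  :0 = con (0 , 0)
  :1 = con (1 , 0)

  -- Inequalities in an ordered field

  -- The usual form of an inequality proof below: a certificate e, assembled from nonnegative
  -- quantities, whose equality with y - x is a polynomial identity left to the solver.
  ≤-by : ∀ {x y e} → 0# ≤ e → e ≈ y - x → x ≤ y
  ≤-by {x} {y} {e} 0≤e e≈ = begin
    x          ≈⟨ +-identityˡ x ⟨
    0# + x     ≤⟨ +-monoˡ-≤ x 0≤e ⟩
    e + x      ≈⟨ +-congʳ e≈ ⟩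
    y - x + x  ≈⟨ solve 2 (λ x y → y :- x :+ x := y) refl x y ⟩
    y          ∎
    where open ≤-Reasoning

  0≤- : ∀ {x y} → x ≤ y → 0# ≤ y - x
  0≤- {x} {y} x≤y = begin
    0#     ≈⟨ -‿inverseʳ x ⟨
    x - x  ≤⟨ +-monoˡ-≤ (- x) x≤y ⟩
    y - x  ∎
    where open ≤-Reasoning

  0≤+ : ∀ {x y} → 0# ≤ x → 0# ≤ y → 0# ≤ x + y
  0≤+ {x} {y} 0≤x 0≤y = begin
    0#      ≤⟨ 0≤y ⟩
    y       ≈⟨ +-identityˡ y ⟨
    0# + y  ≤⟨ +-monoˡ-≤ y 0≤x ⟩
    x + y   ∎
    where open ≤-Reasoning

  0≤* : ∀ {x y} → 0# ≤ x → 0# ≤ y → 0# ≤ x * y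
  0≤* = *-nonNeg

  ≰⇒> : ∀ {x y} → ¬ x ≤ y → y < x
  ≰⇒> = Strict.≰⇒> sym ≤.reflexive ≤.total

  <⇒≱ : ∀ {x y} → x < y → ¬ y ≤ x
  <⇒≱ = Strict.<⇒≱ ≤.antisym

  ≮⇒≥ : ∀ {x y} → ¬ y < x → x ≤ y
  ≮⇒≥ {x} {y} ¬y<x with em {x ≤ y}
  ... | yes x≤y = x≤y
  ... | no  x≰y = contradiction (≰⇒> x≰y) ¬y<x

  +-mono-≤ : ∀ {x y u v} → x ≤ y → u ≤ v → x + u ≤ y + v
  +-mono-≤ {x} {y} {u} {v} x≤y u≤v = ≤-by (0≤+ (0≤- x≤y) (0≤- u≤v))
    (solve 4 (λ x y u v → (y :- x) :+ (v :- u) := (y :+ v) :- (x :+ u)) refl x y u v)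

  +-monoʳ-≤ : ∀ z {x y} → x ≤ y → z + x ≤ z + y
  +-monoʳ-≤ z = +-mono-≤ ≤.refl

  *-monoˡ-≤ : ∀ {z x y} → 0# ≤ z → x ≤ y → z * x ≤ z * y
  *-monoˡ-≤ {z} {x} {y} 0≤z x≤y = ≤-by (0≤* 0≤z (0≤- x≤y))
    (solve 3 (λ z x y → z :* (y :- x) := z :* y :- z :* x) refl z x y)

  *-monoʳ-≤ : ∀ {z x y} → 0# ≤ z → x ≤ y → x * z ≤ y * z
  *-monoʳ-≤ {z} {x} {y} 0≤z x≤y = ≤-by (0≤* 0≤z (0≤- x≤y))
    (solve 3 (λ z x y → z :* (y :- x) := y :* z :- x :* z) refl z x y)

  *-mono-≤ : ∀ {x y u v} → 0# ≤ u → 0# ≤ y → x ≤ y → u ≤ v → x * u ≤ y * v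
  *-mono-≤ 0≤u 0≤y x≤y u≤v = ≤.trans (*-monoʳ-≤ 0≤u x≤y) (*-monoˡ-≤ 0≤y u≤v)

  -- If 1 ≤ 0, then 1 = (0 - 1)² is nonnegative all the same.
  0≤1 : 0# ≤ 1#
  0≤1 with ≤.total 0# 1#
  ... | inj₁ 0≤1 = 0≤1
  ... | inj₂ 1≤0 = ≤-by (0≤* (0≤- 1≤0) (0≤- 1≤0))
    (solve 0 ((:0 :- :1) :* (:0 :- :1) := :1 :- :0) refl)

  0<1 : 0# < 1#
  0<1 = 0≤1 , 0≉1

  0≤fromℕ : ∀ n → 0# ≤ fromℕ n
  0≤fromℕ zero    = ≤.refl
  0≤fromℕ (suc n) = 0≤+ 0≤1 (0≤fromℕ n)

  fromℕ-mono : ∀ {m n} → m ℕ.≤ n → fromℕ m ≤ fromℕ n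
  fromℕ-mono {n = n} ℕ.z≤n = 0≤fromℕ n
  fromℕ-mono (ℕ.s≤s m≤n) = +-monoʳ-≤ 1# (fromℕ-mono m≤n)

  fromℕ-mono-< : ∀ {m n} → m ℕ.< n → fromℕ m < fromℕ n
  fromℕ-mono-< {m} {n} m<n = begin-strict
    fromℕ m         <⟨ ≰⇒> (λ 1+m≤m → <⇒≱ 0<1 (≤-by (0≤- 1+m≤m)
                         (solve 1 (λ m → m :- (:1 :+ m) := :0 :- :1) refl (fromℕ m)))) ⟩
    fromℕ (suc m)   ≤⟨ fromℕ-mono m<n ⟩
    fromℕ n         ∎
    where open ≤-Reasoning

  0<fromℕ : ∀ n → .{{ℕ.NonZero n}} → 0# < fromℕ n
  0<fromℕ n = fromℕ-mono-< (ℕ.>-nonZero⁻¹ n)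

  0<⇒≉0 : ∀ {x} → 0# < x → x ≉ 0#
  0<⇒≉0 (_ , 0≉x) x≈0 = 0≉x (sym x≈0)

  invert : ∀ {x} → 0# < x → ∃ λ i → 0# ≤ i × i * x ≈ 1#
  invert {x} 0<x with ≉0⇒invertible x (0<⇒≉0 0<x)
  ... | i , i*x≈1 , _ with ≤.total 0# i
  ... | inj₁ 0≤i = i , 0≤i , i*x≈1
  ... | inj₂ i≤0 = ⊥-elim (<⇒≱ 0<1 (≤-by (0≤* (0≤- i≤0) (proj₁ 0<x)) (begin
    (0# - i) * x   ≈⟨ solve 2 (λ i x → (:0 :- i) :* x := :0 :- i :* x) refl i x ⟩
    0# - i * x     ≈⟨ +-congˡ (-‿cong i*x≈1) ⟩
    0# - 1#        ∎)))
    where open ≈-Reasoning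

  *-cancelˡ-≤ : ∀ {z x y} → 0# < z → z * x ≤ z * y → x ≤ y
  *-cancelˡ-≤ {z} {x} {y} 0<z zx≤zy with invert 0<z
  ... | i , 0≤i , iz≈1 = begin
    x            ≈⟨ cancel x ⟨
    i * (z * x)  ≤⟨ *-monoˡ-≤ 0≤i zx≤zy ⟩
    i * (z * y)  ≈⟨ cancel y ⟩
    y            ∎
    where
    open ≤-Reasoning
    cancel : ∀ x → i * (z * x) ≈ x
    cancel x = trans (sym (*-assoc i z x)) (trans (*-congʳ iz≈1) (*-identityˡ x))

  *-cancelˡ-≈ : ∀ {z x y} → 0# < z → z * x ≈ z * y → x ≈ y
  *-cancelˡ-≈ 0<z eq = ≤.antisym (*-cancelˡ-≤ 0<z (≤.reflexive eq)) (*-cancelˡ-≤ 0<z (≤.reflexive (sym eq)))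

  0<* : ∀ {x y} → 0# < x → 0# < y → 0# < x * y
  0<* {x} {y} 0<x 0<y = ≰⇒> λ xy≤0 → <⇒≱ 0<y (*-cancelˡ-≤ 0<x (≤.trans xy≤0 (≤.reflexive (sym (zeroʳ x)))))

  <-by : ∀ {x y e} → 0# < e → e ≈ y - x → x < y
  <-by {x} {y} {e} 0<e e≈ = ≰⇒> λ y≤x → <⇒≱ 0<e (≤-by (0≤- y≤x)
    (trans (solve 2 (λ x y → x :- y := :0 :- (y :- x)) refl x y) (+-congˡ (-‿cong (sym e≈)))))

  0<- : ∀ {x y} → x < y → 0# < y - x
  0<- {x} {y} x<y = ≰⇒> λ y-x≤0 → <⇒≱ x<y (≤-by (0≤- y-x≤0)
    (solve 2 (λ x y → :0 :- (y :- x) := x :- y) refl x y))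

  0<+ : ∀ {x y} → 0# < x → 0# ≤ y → 0# < x + y
  0<+ {x} {y} 0<x 0≤y = ≰⇒> λ x+y≤0 → <⇒≱ 0<x (≤-by (0≤+ (0≤- x+y≤0) 0≤y)
    (solve 2 (λ x y → (:0 :- (x :+ y)) :+ y := :0 :- x) refl x y))

  *-monoˡ-< : ∀ {z x y} → 0# < z → x < y → z * x < z * y
  *-monoˡ-< 0<z x<y = ≰⇒> (<⇒≱ x<y ∘ *-cancelˡ-≤ 0<z)

  ²-cancel-≤ : ∀ {x y} → 0# ≤ y → x * x ≤ y * y → x ≤ y
  ²-cancel-≤ {x} {y} 0≤y x²≤y² = ≮⇒≥ λ y<x →
    <⇒≱ (0<* (0<- y<x) (0<+ (Strict.≤-<-trans ≤.trans ≤.antisym ≤.≤-respˡ-≈ 0≤y y<x) 0≤y)) (≤-by (0≤- x²≤y²)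
      (solve 2 (λ x y → y :* y :- x :* x := :0 :- (x :- y) :* (x :+ y)) refl x y))

  -- Division and the Archimedean property

  the-spec : ∀ {P : Carrier → Set} → ∃ P → P (the P)
  the-spec {P} ∃P with em {∃ P}
  ... | yes (_ , Px) = Px
  ... | no  ¬∃P      = contradiction ∃P ¬∃P

  /-* : ∀ x {y} → 0# < y → (x / y) * y ≈ x
  /-* x {y} 0<y = proj₂ (the-spec {λ z → y ≉ 0# × z * y ≈ x} (let i , _ , iy≈1 = invert 0<y in
    x * i , 0<⇒≉0 0<y , trans (*-assoc x i y) (trans (*-congˡ iy≈1) (*-identityʳ x))))

  ≤/ : ∀ {x y z} → 0# < y → x * y ≤ z → x ≤ z / y
  ≤/ {x} {y} {z} 0<y xy≤z = *-cancelˡ-≤ 0<y (begin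
    y * x        ≈⟨ *-comm y x ⟩
    x * y        ≤⟨ xy≤z ⟩
    z            ≈⟨ /-* z 0<y ⟨
    (z / y) * y  ≈⟨ *-comm (z / y) y ⟩
    y * (z / y)  ∎)
    where open ≤-Reasoning

  ≤/⁻ : ∀ {x y z} → 0# < y → x ≤ z / y → x * y ≤ z
  ≤/⁻ {x} {y} {z} 0<y x≤z/y = ≤.trans (*-monoʳ-≤ (proj₁ 0<y) x≤z/y) (≤.reflexive (/-* z 0<y))

  -- If the natural numbers were bounded, with supremum s, then s - 1 would be a smaller upper
  -- bound.
  archimedean : ∀ x → ∃ λ n → x ≤ fromℕ n
  archimedean x with em {∃ λ n → x ≤ fromℕ n}
  ... | yes n∃ = n∃
  ... | no  n∄ = ⊥-elim (<⇒≱ 0<1 (≤-by (0≤- s≤s-1) (solve 1 (λ s → (s :- :1) :- s := :0 :- :1) refl s)))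
    where
    bounded : UpperBound (λ z → ∃ λ n → z ≈ fromℕ n) x
    bounded z (n , z≈n) = ≤.trans (≤.reflexive z≈n) (proj₁ (≰⇒> λ x≤n → n∄ (n , x≤n)))
    sup = supremum (λ z → ∃ λ n → z ≈ fromℕ n) (0# , 0 , refl) (x , bounded)
    s = proj₁ sup
    s≤s-1 : s ≤ s - 1#
    s≤s-1 = proj₂ (proj₂ sup) (s - 1#) λ z (n , z≈n) →
      ≤-by (0≤- (proj₁ (proj₂ sup) (fromℕ (suc n)) (suc n , refl)))
        (trans (solve 2 (λ s n → s :- (:1 :+ n) := (s :- :1) :- n) refl s (fromℕ n)) (+-congˡ (-‿cong (sym z≈n))))

  -- Absolute bounds, null sequences and limits

  infix 4 _≤±_

  -- This is |x| ≤ a, expressed without an absolute value.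
  _≤±_ : Carrier → Carrier → Set
  x ≤± a = - a ≤ x × x ≤ a

  ≤±-cong : ∀ {x y a b} → x ≈ y → a ≈ b → x ≤± a → y ≤± b
  ≤±-cong x≈y a≈b (-a≤x , x≤a) =
    ≤.≤-respˡ-≈ (-‿cong a≈b) (≤.≤-respʳ-≈ x≈y -a≤x) , ≤.≤-respˡ-≈ x≈y (≤.≤-respʳ-≈ a≈b x≤a)

  ≤±-weaken : ∀ {x a b} → a ≤ b → x ≤± a → x ≤± b
  ≤±-weaken {x} {a} {b} a≤b (-a≤x , x≤a) =
    ≤-by (0≤+ (0≤- -a≤x) (0≤- a≤b)) (solve 3 (λ x a b → (x :- :- a) :+ (b :- a) := x :- :- b) refl x a b) , ≤.trans x≤a a≤b

  0≤⇒≤± : ∀ {x} → 0# ≤ x → x ≤± x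
  0≤⇒≤± {x} 0≤x = ≤-by (0≤+ 0≤x 0≤x) (solve 1 (λ x → x :+ x := x :- :- x) refl x) , ≤.refl

  ≤±-+ : ∀ {x y a b} → x ≤± a → y ≤± b → x + y ≤± a + b
  ≤±-+ {x} {y} {a} {b} (-a≤x , x≤a) (-b≤y , y≤b) =
    ≤-by (0≤+ (0≤- -a≤x) (0≤- -b≤y)) (solve 4 (λ x y a b → (x :- :- a) :+ (y :- :- b) := (x :+ y) :- :- (a :+ b)) refl x y a b) ,
    +-mono-≤ x≤a y≤b

  0<2 : 0# < 1# + 1#
  0<2 = 0<+ 0<1 0≤1

  -- Both 2 (a b + x y) and 2 (a b - x y) are sums of two products of nonnegative factors among a ±
  -- x and b ± y.
  ≤±-* : ∀ {x y a b} → x ≤± a → y ≤± b → x * y ≤± a * b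
  ≤±-* {x} {y} {a} {b} (-a≤x , x≤a) (-b≤y , y≤b) =
    *-cancelˡ-≤ 0<2 (≤-by (0≤+ (0≤* (0≤- x≤a) (0≤- y≤b)) (0≤* (0≤- -a≤x) (0≤- -b≤y)))
      (solve 4 (λ x y a b → (a :- x) :* (b :- y) :+ (x :- :- a) :* (y :- :- b) := (:1 :+ :1) :* (x :* y) :- (:1 :+ :1) :* :- (a :* b)) refl x y a b)) ,
    *-cancelˡ-≤ 0<2 (≤-by (0≤+ (0≤* (0≤- x≤a) (0≤- -b≤y)) (0≤* (0≤- -a≤x) (0≤- y≤b)))
      (solve 4 (λ x y a b → (a :- x) :* (y :- :- b) :+ (x :- :- a) :* (b :- y) := (:1 :+ :1) :* (a :* b) :- (:1 :+ :1) :* (x :* y)) refl x y a b))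

  divide : ∀ {c ε} → 0# < c → 0# < ε → ∃ λ δ → 0# < δ × c * δ ≈ ε
  divide {c} {ε} 0<c 0<ε with invert 0<c
  ... | i , _ , ic≈1 = i * ε , ≰⇒> (λ iε≤0 → <⇒≱ 0<ε (begin
      ε            ≈⟨ ciε≈ε ⟨
      c * (i * ε)  ≤⟨ *-monoˡ-≤ (proj₁ 0<c) iε≤0 ⟩
      c * 0#       ≈⟨ zeroʳ c ⟩
      0#           ∎)) , ciε≈ε
    where
    open ≤-Reasoning
    ciε≈ε : c * (i * ε) ≈ ε
    ciε≈ε = trans (sym (*-assoc c i ε)) (trans (*-congʳ (trans (*-comm c i) ic≈1)) (*-identityˡ ε))

  Eventually : (ℕ → Set) → Set
  Eventually P = ∃ λ N → ∀ n → N ℕ.≤ n → P n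

  eventually-∩ : ∀ {P Q R : ℕ → Set} → (∀ {n} → P n → Q n → R n) → Eventually P → Eventually Q → Eventually R
  eventually-∩ f (M , p) (N , q) = M ℕ.⊔ N , λ n M⊔N≤n →
    f (p n (ℕ.≤-trans (ℕ.m≤m⊔n M N) M⊔N≤n)) (q n (ℕ.≤-trans (ℕ.m≤n⊔m M N) M⊔N≤n))

  always : ∀ {P : ℕ → Set} → (∀ n → P n) → Eventually P
  always p = 0 , λ n _ → p n

  Null : (ℕ → Carrier) → Set
  Null z = ∀ ε → 0# < ε → Eventually (λ n → z n ≤± ε)

  ⟶⇒null : ∀ {s l} → s ⟶ l → Null (λ n → s n - l)
  ⟶⇒null {s} {l} s⟶l ε 0<ε = proj₁ (s⟶l ε 0<ε) , λ n N≤n →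
    let l-ε<s , s<l+ε = proj₂ (s⟶l ε 0<ε) n N≤n in
    ≤-by (0≤- (proj₁ l-ε<s)) (solve 3 (λ s l e → s :- (l :- e) := (s :- l) :- :- e) refl (s n) l ε) ,
    ≤-by (0≤- (proj₁ s<l+ε)) (solve 3 (λ s l e → (l :+ e) :- s := e :- (s :- l)) refl (s n) l ε)

  -- Halving ε turns the weak bounds of null sequences into the strict ones in the definition of the
  -- limit.
  ≤±⇒near : ∀ {x l δ ε} → 0# < δ → (1# + 1#) * δ ≈ ε → x - l ≤± δ → l - ε < x × x < l + ε
  ≤±⇒near {x} {l} {δ} {ε} 0<δ 2δ≈ε (-δ≤ , ≤δ) =
    <-by (0<+ 0<δ (0≤- -δ≤)) (trans
      (solve 3 (λ s l d → d :+ ((s :- l) :- :- d) := s :- (l :- (:1 :+ :1) :* d)) refl x l δ)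
      (+-congˡ (-‿cong (+-congˡ (-‿cong 2δ≈ε))))) ,
    <-by (0<+ 0<δ (0≤- ≤δ)) (trans
      (solve 3 (λ s l d → d :+ (d :- (s :- l)) := (l :+ (:1 :+ :1) :* d) :- s) refl x l δ)
      (+-congʳ (+-congˡ 2δ≈ε)))

  null⇒⟶ : ∀ {s l} → Null (λ n → s n - l) → s ⟶ l
  null⇒⟶ null ε 0<ε = let δ , 0<δ , 2δ≈ε = divide 0<2 0<ε in
    proj₁ (null δ 0<δ) , λ n N≤n → ≤±⇒near 0<δ 2δ≈ε (proj₂ (null δ 0<δ) n N≤n)

  null-cong : ∀ {z w} → (∀ n → z n ≈ w n) → Null z → Null w
  null-cong z≈w null ε 0<ε = proj₁ (null ε 0<ε) , λ n N≤n → ≤±-cong (z≈w n) refl (proj₂ (null ε 0<ε) n N≤n)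

  null-dominated : ∀ {z w} → Eventually (λ n → z n ≤± w n) → Null w → Null z
  null-dominated dom null ε 0<ε = eventually-∩ (λ z≤±w w≤±ε → ≤±-weaken (proj₂ w≤±ε) z≤±w) dom (null ε 0<ε)

  null-+ : ∀ {z w} → Null z → Null w → Null (λ n → z n + w n)
  null-+ nz nw ε 0<ε = let δ , 0<δ , 2δ≈ε = divide 0<2 0<ε in eventually-∩
    (λ z w → ≤±-cong refl (trans (solve 1 (λ d → d :+ d := (:1 :+ :1) :* d) refl δ) 2δ≈ε) (≤±-+ z w))
    (nz δ 0<δ) (nw δ 0<δ)

  bounded-*-null : ∀ {b z : ℕ → Carrier} {C} → 0# < C → Eventually (λ n → b n ≤± C) → Null z → Null (λ n → b n * z n)
  bounded-*-null {b} {z} {C} 0<C bounded null ε 0<ε = let δ , 0<δ , Cδ≈ε = divide 0<C 0<ε in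
    eventually-∩ {R = λ n → b n * z n ≤± ε} (λ b z → ≤±-cong refl Cδ≈ε (≤±-* b z)) bounded (null δ 0<δ)

  ≤±-exists : ∀ x → ∃ λ C → 0# < C × x ≤± C
  ≤±-exists x with ≤.total 0# x
  ... | inj₁ 0≤x = 1# + x , 0<+ 0<1 0≤x , ≤±-weaken (≤-by 0≤1 (solve 1 (λ x → :1 := (:1 :+ x) :- x) refl x)) (0≤⇒≤± 0≤x)
  ... | inj₂ x≤0 = 1# - x , 0<+ 0<1 0≤-x ,
    ≤-by 0≤1 (solve 1 (λ x → :1 := x :- :- (:1 :- x)) refl x) ,
    ≤-by (0≤+ 0≤1 (0≤+ 0≤-x 0≤-x)) (solve 1 (λ x → :1 :+ (:- x :+ :- x) := (:1 :- x) :- x) refl x)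
    where
    0≤-x : 0# ≤ - x
    0≤-x = ≤-by (0≤- x≤0) (solve 1 (λ x → :0 :- x := :- x :- :0) refl x)

  const-*-null : ∀ c {z} → Null z → Null (λ n → c * z n)
  const-*-null c {z} = let C , 0<C , c≤±C = ≤±-exists c in bounded-*-null {const c} {z} 0<C (always (const c≤±C))

  null-* : ∀ {z w} → Null z → Null w → Null (λ n → z n * w n)
  null-* {z} {w} nz = bounded-*-null {z} {w} 0<1 (nz 1# 0<1)

  ⟶-cong : ∀ {s t k l} → (∀ n → s n ≈ t n) → k ≈ l → s ⟶ k → t ⟶ l
  ⟶-cong s≈t k≈l s⟶k = null⇒⟶ (null-cong (λ n → +-cong (s≈t n) (-‿cong k≈l)) (⟶⇒null s⟶k))

  ⟶-+ : ∀ {s t k l} → s ⟶ k → t ⟶ l → (λ n → s n + t n) ⟶ k + l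
  ⟶-+ {s} {t} {k} {l} s⟶k t⟶l = null⇒⟶ (null-cong
    (λ n → solve 4 (λ s t k l → (s :- k) :+ (t :- l) := (s :+ t) :- (k :+ l)) refl (s n) (t n) k l)
    (null-+ (⟶⇒null s⟶k) (⟶⇒null t⟶l)))

  ⟶-*ˡ : ∀ c {s l} → s ⟶ l → (λ n → c * s n) ⟶ c * l
  ⟶-*ˡ c {s} {l} s⟶l = null⇒⟶ (null-cong
    (λ n → solve 3 (λ c s l → c :* (s :- l) := c :* s :- c :* l) refl c (s n) l)
    (const-*-null c (⟶⇒null s⟶l)))

  ⟶-* : ∀ {s t k l} → s ⟶ k → t ⟶ l → (λ n → s n * t n) ⟶ k * l
  ⟶-* {s} {t} {k} {l} s⟶k t⟶l = null⇒⟶ (null-cong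
    (λ n → solve 4 (λ s t k l → (s :- k) :* (t :- l) :+ (k :* (t :- l) :+ l :* (s :- k)) := s :* t :- k :* l) refl (s n) (t n) k l)
    (null-+ (null-* (⟶⇒null s⟶k) (⟶⇒null t⟶l)) (null-+ (const-*-null k (⟶⇒null t⟶l)) (const-*-null l (⟶⇒null s⟶k)))))

  ⟶-subsequence : ∀ {s l} (f : ℕ → ℕ) → (∀ n → n ℕ.≤ f n) → s ⟶ l → s ∘ f ⟶ l
  ⟶-subsequence f n≤fn s⟶l ε 0<ε = let N , h = s⟶l ε 0<ε in N , λ n N≤n → h (f n) (ℕ.≤-trans N≤n (n≤fn n))

  ⟶-≤ : ∀ {s t k l} → Eventually (λ n → s n ≤ t n) → s ⟶ k → t ⟶ l → k ≤ l
  ⟶-≤ {s} {t} {k} {l} s≤t s⟶k t⟶l = ≮⇒≥ λ l<k →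
    let δ , 0<δ , 2δ≈ = divide 0<2 (0<- l<k)
        N , h = eventually-∩ {R = λ n → k - δ < l + δ}
          (λ s≤t (k-δ<s , t<l+δ) → Strict.<-≤-trans sym ≤.trans ≤.antisym ≤.≤-respʳ-≈ k-δ<s (≤.trans s≤t (proj₁ t<l+δ)))
          s≤t (eventually-∩ (λ hs ht → proj₁ hs , proj₂ ht) (s⟶k δ 0<δ) (t⟶l δ 0<δ))
    in <⇒≱ (h N ℕ.≤-refl) (≤.reflexive (begin
      l + δ                          ≈⟨ solve 3 (λ k l d → l :+ d := (k :- d) :+ ((:1 :+ :1) :* d :- (k :- l))) refl k l δ ⟩
      (k - δ) + ((1# + 1#) * δ - (k - l)) ≈⟨ +-congˡ (trans (+-congʳ 2δ≈) (-‿inverseʳ (k - l))) ⟩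
      (k - δ) + 0#                   ≈⟨ +-identityʳ (k - δ) ⟩
      k - δ                          ∎))
    where open ≈-Reasoning

  ⟶-unique : ∀ {s k l} → s ⟶ k → s ⟶ l → k ≈ l
  ⟶-unique s⟶k s⟶l = ≤.antisym (⟶-≤ (always λ _ → ≤.refl) s⟶k s⟶l) (⟶-≤ (always λ _ → ≤.refl) s⟶l s⟶k)

  ⟶-const : ∀ c → const c ⟶ c
  ⟶-const c = null⇒⟶ λ ε 0<ε → always λ _ → ≤±-cong (sym (-‿inverseʳ c)) refl
    (≤±-weaken (proj₁ 0<ε) (0≤⇒≤± ≤.refl))

  -- Monotone convergence and finite sums

  monotone : ∀ {s : ℕ → Carrier} → (∀ n → s n ≤ s (suc n)) → ∀ {m n} → m ℕ.≤ n → s m ≤ s n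
  monotone {s} step m≤n = go (ℕ.≤⇒≤′ m≤n)
    where
    go : ∀ {m n} → m ℕ.≤′ n → s m ≤ s n
    go ℕ.≤′-refl       = ≤.refl
    go (ℕ.≤′-step m≤n) = ≤.trans (go m≤n) (step _)

  monotone-convergent : ∀ {s b} → (∀ n → s n ≤ s (suc n)) → (∀ n → s n ≤ b) → ∃ (s ⟶_)
  monotone-convergent {s} {b} step s≤b = l , null⇒⟶ λ ε 0<ε → near ε 0<ε (em {∃ λ n → l - ε < s n})
    where
    Value : Carrier → Set
    Value x = ∃ λ n → x ≈ s n
    sup = supremum Value (s 0 , 0 , refl) (b , λ x (n , x≈) → ≤.trans (≤.reflexive x≈) (s≤b n))
    l = proj₁ sup
    s≤l : ∀ n → s n ≤ l
    s≤l n = proj₁ (proj₂ sup) (s n) (n , refl)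
    near : ∀ ε → 0# < ε → Dec (∃ λ n → l - ε < s n) → Eventually (λ n → s n - l ≤± ε)
    near ε 0<ε (yes (N , l-ε<s)) = N , λ n N≤n →
      ≤-by (0≤- (≤.trans (proj₁ l-ε<s) (monotone step N≤n))) (solve 3 (λ s l e → s :- (l :- e) := (s :- l) :- :- e) refl (s n) l ε) ,
      ≤-by (0≤+ (proj₁ 0<ε) (0≤- (s≤l n))) (solve 3 (λ s l e → e :+ (l :- s) := e :- (s :- l)) refl (s n) l ε)
    near ε 0<ε (no ∄n) = ⊥-elim (<⇒≱ 0<ε (≤-by (0≤- (proj₂ (proj₂ sup) (l - ε) λ x (n , x≈) →
        ≤.trans (≤.reflexive x≈) (≮⇒≥ λ l-ε<s → ∄n (n , l-ε<s))))
      (solve 2 (λ l e → (l :- e) :- l := :0 :- e) refl l ε)))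

  ∑-cong : ∀ n {f g : ℕ → Carrier} → (∀ {i} → i ℕ.< n → f i ≈ g i) → ∑ n f ≈ ∑ n g
  ∑-cong zero    f≈g = refl
  ∑-cong (suc n) f≈g = +-cong (f≈g (ℕ.s≤s ℕ.z≤n)) (∑-cong n (f≈g ∘ ℕ.s≤s))

  ∑-last : ∀ n (f : ℕ → Carrier) → ∑ (suc n) f ≈ ∑ n f + f n
  ∑-last zero    f = trans (+-identityʳ (f 0)) (sym (+-identityˡ (f 0)))
  ∑-last (suc n) f = trans (+-congˡ (∑-last n (f ∘ suc))) (sym (+-assoc (f 0) (∑ n (f ∘ suc)) (f (suc n))))

  ∑-+ : ∀ n (f g : ℕ → Carrier) → ∑ n (λ i → f i + g i) ≈ ∑ n f + ∑ n g
  ∑-+ zero    f g = sym (+-identityˡ 0#)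
  ∑-+ (suc n) f g = trans (+-congˡ (∑-+ n (f ∘ suc) (g ∘ suc)))
    (solve 4 (λ a b c d → (a :+ b) :+ (c :+ d) := (a :+ c) :+ (b :+ d)) refl (f 0) (g 0) (∑ n (f ∘ suc)) (∑ n (g ∘ suc)))

  ∑-*ˡ : ∀ n c (f : ℕ → Carrier) → c * ∑ n f ≈ ∑ n (λ i → c * f i)
  ∑-*ˡ zero    c f = zeroʳ c
  ∑-*ˡ (suc n) c f = trans (distribˡ c (f 0) (∑ n (f ∘ suc))) (+-congˡ (∑-*ˡ n c (f ∘ suc)))

  ∑-*ʳ : ∀ n c (f : ℕ → Carrier) → ∑ n f * c ≈ ∑ n (λ i → f i * c)
  ∑-*ʳ n c f = trans (*-comm (∑ n f) c) (trans (∑-*ˡ n c f) (∑-cong n λ {i} _ → *-comm c (f i)))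

  ∑-mono : ∀ n {f g : ℕ → Carrier} → (∀ {i} → i ℕ.< n → f i ≤ g i) → ∑ n f ≤ ∑ n g
  ∑-mono zero    f≤g = ≤.refl
  ∑-mono (suc n) f≤g = +-mono-≤ (f≤g (ℕ.s≤s ℕ.z≤n)) (∑-mono n (f≤g ∘ ℕ.s≤s))

  ∑-≤± : ∀ n {f g : ℕ → Carrier} → (∀ {i} → i ℕ.< n → f i ≤± g i) → ∑ n f ≤± ∑ n g
  ∑-≤± zero    f≤±g = 0≤⇒≤± ≤.refl
  ∑-≤± (suc n) f≤±g = ≤±-+ (f≤±g (ℕ.s≤s ℕ.z≤n)) (∑-≤± n (f≤±g ∘ ℕ.s≤s))

  ∑-step : ∀ {f : ℕ → Carrier} → (∀ n → 0# ≤ f n) → ∀ n → ∑ n f ≤ ∑ (suc n) f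
  ∑-step {f} 0≤f n = ≤-by (0≤f n) (trans (solve 2 (λ s t → t := (s :+ t) :- s) refl (∑ n f) (f n)) (+-congʳ (sym (∑-last n f))))

  ≤±-cancel : ∀ {c x y} → 0# < c → c * x ≤± c * y → x ≤± y
  ≤±-cancel {c} {x} {y} 0<c (-cy≤cx , cx≤cy) =
    *-cancelˡ-≤ 0<c (≤.≤-respˡ-≈ (solve 2 (λ c y → :- (c :* y) := c :* :- y) refl c y) -cy≤cx) ,
    *-cancelˡ-≤ 0<c cx≤cy

  -- The exponential series

  term : Carrier → ℕ → Carrier
  term x k = x ^ k / fromℕ (k ℕ.!)

  0<! : ∀ k → 0# < fromℕ (k ℕ.!)
  0<! k = 0<fromℕ (k ℕ.!) {{k ℕ.!≢0}}

  term-! : ∀ x k → term x k * fromℕ (k ℕ.!) ≈ x ^ k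
  term-! x k = /-* (x ^ k) (0<! k)

  term-zero : ∀ x → term x 0 ≈ 1#
  term-zero x = begin
    term x 0             ≈⟨ *-identityʳ (term x 0) ⟨
    term x 0 * 1#        ≈⟨ *-congˡ fromℕ-1 ⟨
    term x 0 * fromℕ 1   ≈⟨ term-! x 0 ⟩
    1#                   ∎
    where open ≈-Reasoning

  term-suc : ∀ x k → fromℕ (suc k) * term x (suc k) ≈ x * term x k
  term-suc x k = *-cancelˡ-≈ (0<! k) (begin
    fromℕ (k ℕ.!) * (fromℕ (suc k) * term x (suc k))
      ≈⟨ solve 3 (λ f s t → f :* (s :* t) := t :* (s :* f)) refl (fromℕ (k ℕ.!)) (fromℕ (suc k)) (term x (suc k)) ⟩
    term x (suc k) * (fromℕ (suc k) * fromℕ (k ℕ.!))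
      ≈⟨ *-congˡ (fromℕ-* (suc k) (k ℕ.!)) ⟨
    term x (suc k) * fromℕ (suc k ℕ.!)
      ≈⟨ term-! x (suc k) ⟩
    x * x ^ k
      ≈⟨ *-congˡ (term-! x k) ⟨
    x * (term x k * fromℕ (k ℕ.!))
      ≈⟨ solve 3 (λ f x t → x :* (t :* f) := f :* (x :* t)) refl (fromℕ (k ℕ.!)) x (term x k) ⟩
    fromℕ (k ℕ.!) * (x * term x k) ∎)
    where open ≈-Reasoning

  term-cong : ∀ {x y} k → x ≈ y → term x k ≈ term y k
  term-cong {x} {y} k x≈y = *-cancelˡ-≈ (0<! k) (begin
    fromℕ (k ℕ.!) * term x k  ≈⟨ *-comm (fromℕ (k ℕ.!)) (term x k) ⟩
    term x k * fromℕ (k ℕ.!)  ≈⟨ term-! x k ⟩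
    x ^ k                     ≈⟨ ^-congˡ k x≈y ⟩
    y ^ k                     ≈⟨ term-! y k ⟨
    term y k * fromℕ (k ℕ.!)  ≈⟨ *-comm (term y k) (fromℕ (k ℕ.!)) ⟩
    fromℕ (k ℕ.!) * term y k  ∎)
    where open ≈-Reasoning

  term-≤± : ∀ {x y} → x ≤± y → ∀ k → term x k ≤± term y k
  term-≤± {x} {y} x≤±y zero    = ≤±-cong (sym (term-zero x)) (sym (term-zero y)) (0≤⇒≤± 0≤1)
  term-≤± {x} {y} x≤±y (suc k) = ≤±-cancel (0<fromℕ (suc k))
    (≤±-cong (sym (term-suc x k)) (sym (term-suc y k)) (≤±-* x≤±y (term-≤± x≤±y k)))

  0≤term : ∀ {x} → 0# ≤ x → ∀ k → 0# ≤ term x k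
  0≤term {x} 0≤x zero    = ≤.≤-respʳ-≈ (sym (term-zero x)) 0≤1
  0≤term {x} 0≤x (suc k) = *-cancelˡ-≤ (0<fromℕ (suc k)) (begin
    fromℕ (suc k) * 0#              ≈⟨ zeroʳ (fromℕ (suc k)) ⟩
    0#                              ≤⟨ 0≤* 0≤x (0≤term 0≤x k) ⟩
    x * term x k                    ≈⟨ term-suc x k ⟨
    fromℕ (suc k) * term x (suc k)  ∎)
    where open ≤-Reasoning

  expSum : Carrier → ℕ → Carrier
  expSum x n = ∑ n (term x)

  -- The terms eventually halve, so that expSum x n + 2 term x n decreases.
  expSum-bounded : ∀ {x} → 0# ≤ x → ∃ λ b → ∀ n → expSum x n ≤ b
  expSum-bounded {x} 0≤x = D K , bound
    where
    open ≤-Reasoning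
    K = proj₁ (archimedean (x + x))
    2x≤K : x + x ≤ fromℕ K
    2x≤K = proj₂ (archimedean (x + x))
    D : ℕ → Carrier
    D n = expSum x n + (term x n + term x n)
    halving : ∀ {n} → K ℕ.≤ n → term x (suc n) + term x (suc n) ≤ term x n
    halving {n} K≤n = *-cancelˡ-≤ (0<fromℕ (suc n)) (begin
      fromℕ (suc n) * (term x (suc n) + term x (suc n))
        ≈⟨ distribˡ (fromℕ (suc n)) (term x (suc n)) (term x (suc n)) ⟩
      fromℕ (suc n) * term x (suc n) + fromℕ (suc n) * term x (suc n)
        ≈⟨ +-cong (term-suc x n) (term-suc x n) ⟩
      x * term x n + x * term x n
        ≈⟨ distribʳ (term x n) x x ⟨
      (x + x) * term x n
        ≤⟨ *-monoʳ-≤ (0≤term 0≤x n) (≤.trans 2x≤K (fromℕ-mono (ℕ.m≤n⇒m≤1+n K≤n))) ⟩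
      fromℕ (suc n) * term x n ∎)
    decreasing : ∀ {n} → K ℕ.≤ n → D (suc n) ≤ D n
    decreasing {n} K≤n = begin
      D (suc n)                          ≤⟨ +-mono-≤ (≤.reflexive (∑-last n (term x))) (halving K≤n) ⟩
      expSum x n + term x n + term x n   ≈⟨ +-assoc (expSum x n) (term x n) (term x n) ⟩
      D n                                ∎
    D≤DK : ∀ {n} → K ℕ.≤′ n → D n ≤ D K
    D≤DK ℕ.≤′-refl       = ≤.refl
    D≤DK (ℕ.≤′-step K≤n) = ≤.trans (decreasing (ℕ.≤′⇒≤ K≤n)) (D≤DK K≤n)
    expSum≤D : ∀ n → expSum x n ≤ D n
    expSum≤D n = ≤-by (0≤+ (0≤term 0≤x n) (0≤term 0≤x n))
      (solve 2 (λ s t → t :+ t := (s :+ (t :+ t)) :- s) refl (expSum x n) (term x n))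
    bound : ∀ n → expSum x n ≤ D K
    bound n with ℕ.≤-total K n
    ... | inj₁ K≤n = ≤.trans (expSum≤D n) (D≤DK (ℕ.≤⇒≤′ K≤n))
    ... | inj₂ n≤K = ≤.trans (monotone (∑-step (0≤term 0≤x)) n≤K) (expSum≤D K)

  -- With h = g - f one has 0 ≤ h ≤ 2 g, so f = g - h is a difference of two nonnegative series with
  -- bounded partial sums, and monotone convergence applies to each.
  dominated-convergent : ∀ {f g : ℕ → Carrier} {b} → (∀ k → f k ≤± g k) → (∀ k → 0# ≤ g k) → (∀ n → ∑ n g ≤ b) →
    Convergent (λ n → ∑ n f)
  dominated-convergent {f} {g} {b} f≤±g 0≤g ∑g≤b =
    let l , ∑h⟶l = monotone-convergent (∑-step 0≤h) ∑h≤2b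
        k , ∑g⟶k = monotone-convergent (∑-step 0≤g) ∑g≤b
    in k + - 1# * l , ⟶-cong (λ n → trans (+-congˡ (*-congˡ (∑-+ n g (λ i → - 1# * f i))))
         (trans (+-congˡ (*-congˡ (+-congˡ (sym (∑-*ˡ n (- 1#) f)))))
           (solve 2 (λ g f → g :+ :- :1 :* (g :+ :- :1 :* f) := f) refl (∑ n g) (∑ n f)))) refl
         (⟶-+ ∑g⟶k (⟶-*ˡ (- 1#) ∑h⟶l))
    where
    h : ℕ → Carrier
    h i = g i + - 1# * f i
    0≤h : ∀ n → 0# ≤ h n
    0≤h n = ≤-by (0≤- (proj₂ (f≤±g n))) (solve 2 (λ g f → g :- f := (g :+ :- :1 :* f) :- :0) refl (g n) (f n))
    h≤2g : ∀ n → h n ≤ g n + g n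
    h≤2g n = ≤-by (0≤- (proj₁ (f≤±g n))) (solve 2 (λ g f → f :- :- g := (g :+ g) :- (g :+ :- :1 :* f)) refl (g n) (f n))
    ∑h≤2b : ∀ n → ∑ n h ≤ b + b
    ∑h≤2b n = ≤.trans (∑-mono n λ {i} _ → h≤2g i) (≤.trans (≤.reflexive (∑-+ n g g)) (+-mono-≤ (∑g≤b n) (∑g≤b n)))

  expSum-convergent : ∀ x → Convergent (expSum x)
  expSum-convergent x =
    let y , 0<y , x≤±y = ≤±-exists x
        b , ≤b = expSum-bounded (proj₁ 0<y)
    in dominated-convergent (term-≤± x≤±y) (0≤term (proj₁ 0<y)) ≤b

  expSum-⟶ : ∀ x → expSum x ⟶ exp x
  expSum-⟶ x = the-spec {expSum x ⟶_} (expSum-convergent x)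

  exp-cong : ∀ {x y} → x ≈ y → exp x ≈ exp y
  exp-cong {x} {y} x≈y = ⟶-unique
    (⟶-cong {t = expSum y} (λ n → ∑-cong n λ {i} _ → term-cong i x≈y) refl (expSum-⟶ x)) (expSum-⟶ y)

  expSum≤exp : ∀ {x} → 0# ≤ x → ∀ n → expSum x n ≤ exp x
  expSum≤exp {x} 0≤x n = ⟶-≤ {s = const (expSum x n)} {t = expSum x} (n , λ m n≤m → monotone (∑-step (0≤term 0≤x)) n≤m)
    (⟶-const (expSum x n)) (expSum-⟶ x)

  -- Cauchy products and the functional equation of exp

  convolution : (ℕ → Carrier) → (ℕ → Carrier) → ℕ → Carrier
  convolution a b n = ∑ (suc n) (λ i → a i * b (n ℕ.∸ i))

  -- The sum of `a i * b j` over the triangle i + j < n inside the square i, j < n. Summed along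
  -- antidiagonals, it is a partial sum of the Cauchy product.
  triangle : (ℕ → Carrier) → (ℕ → Carrier) → ℕ → Carrier
  triangle a b n = ∑ n (λ i → a i * ∑ (n ℕ.∸ i) b)

  suc-∸ : ∀ {i n} → i ℕ.< suc n → suc n ℕ.∸ i ≡ suc (n ℕ.∸ i)
  suc-∸ (ℕ.s≤s i≤n) = ℕ.+-∸-assoc 1 i≤n

  triangle-suc : ∀ a b n → triangle a b (suc n) ≈ triangle a b n + convolution a b n
  triangle-suc a b n = begin
    ∑ (suc n) (λ i → a i * ∑ (suc n ℕ.∸ i) b)
      ≈⟨ ∑-cong (suc n) (λ {i} i≤n → trans (*-congˡ (trans (reflexive (≡.cong (λ m → ∑ m b) (suc-∸ i≤n))) (∑-last (n ℕ.∸ i) b)))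
                                        (distribˡ (a i) (∑ (n ℕ.∸ i) b) (b (n ℕ.∸ i)))) ⟩
    ∑ (suc n) (λ i → a i * ∑ (n ℕ.∸ i) b + a i * b (n ℕ.∸ i))
      ≈⟨ ∑-+ (suc n) (λ i → a i * ∑ (n ℕ.∸ i) b) (λ i → a i * b (n ℕ.∸ i)) ⟩
    ∑ (suc n) (λ i → a i * ∑ (n ℕ.∸ i) b) + convolution a b n
      ≈⟨ +-congʳ (∑-last n (λ i → a i * ∑ (n ℕ.∸ i) b)) ⟩
    triangle a b n + a n * ∑ (n ℕ.∸ n) b + convolution a b n
      ≈⟨ +-congʳ (+-congˡ (trans (*-congˡ (reflexive (≡.cong (λ m → ∑ m b) (ℕ.n∸n≡0 n)))) (zeroʳ (a n)))) ⟩
    triangle a b n + 0# + convolution a b n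
      ≈⟨ +-congʳ (+-identityʳ (triangle a b n)) ⟩
    triangle a b n + convolution a b n ∎
    where open ≈-Reasoning

  triangle≈∑ : ∀ a b n → triangle a b n ≈ ∑ n (convolution a b)
  triangle≈∑ a b zero    = refl
  triangle≈∑ a b (suc n) = trans (triangle-suc a b n)
    (trans (+-congʳ (triangle≈∑ a b n)) (sym (∑-last n (convolution a b))))

  product-triangle : ∀ a b n → ∑ n a * ∑ n b - triangle a b n ≈ ∑ n (λ i → a i * (∑ n b - ∑ (n ℕ.∸ i) b))
  product-triangle a b n = sym (begin
    ∑ n (λ i → a i * (∑ n b - ∑ (n ℕ.∸ i) b))
      ≈⟨ ∑-cong n (λ {i} _ → solve 3 (λ a s t → a :* (s :- t) := a :* s :+ :- :1 :* (a :* t)) refl (a i) (∑ n b) (∑ (n ℕ.∸ i) b)) ⟩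
    ∑ n (λ i → a i * ∑ n b + - 1# * (a i * ∑ (n ℕ.∸ i) b))
      ≈⟨ ∑-+ n (λ i → a i * ∑ n b) (λ i → - 1# * (a i * ∑ (n ℕ.∸ i) b)) ⟩
    ∑ n (λ i → a i * ∑ n b) + ∑ n (λ i → - 1# * (a i * ∑ (n ℕ.∸ i) b))
      ≈⟨ +-cong (∑-*ʳ n (∑ n b) a) (∑-*ˡ n (- 1#) (λ i → a i * ∑ (n ℕ.∸ i) b)) ⟨
    ∑ n a * ∑ n b + - 1# * triangle a b n
      ≈⟨ solve 2 (λ p t → p :+ :- :1 :* t := p :- t) refl (∑ n a * ∑ n b) (triangle a b n) ⟩
    ∑ n a * ∑ n b - triangle a b n ∎)
    where open ≈-Reasoning

  ∑-tail-≤± : ∀ {f g : ℕ → Carrier} → (∀ k → f k ≤± g k) → ∀ {m n} → m ℕ.≤′ n → ∑ n f - ∑ m f ≤± ∑ n g - ∑ m g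
  ∑-tail-≤± {f} {g} f≤±g {m} ℕ.≤′-refl =
    ≤±-cong (sym (-‿inverseʳ (∑ m f))) (sym (-‿inverseʳ (∑ m g))) (0≤⇒≤± ≤.refl)
  ∑-tail-≤± {f} {g} f≤±g {m} (ℕ.≤′-step {n = n} m≤n) =
    ≤±-cong (extend f) (extend g) (≤±-+ (∑-tail-≤± f≤±g m≤n) (f≤±g n))
    where
    extend : ∀ f → (∑ n f - ∑ m f) + f n ≈ ∑ (suc n) f - ∑ m f
    extend f = trans (solve 3 (λ s t u → (s :- t) :+ u := (s :+ u) :- t) refl (∑ n f) (∑ m f) (f n)) (+-congʳ (sym (∑-last n f)))

  -- The difference of square and triangle is the sum of `a i * b j` over i, j < n with i + j ≥ n,
  -- and is thus dominated term by term.
  product-triangle-≤± : ∀ {a b c d : ℕ → Carrier} → (∀ k → a k ≤± c k) → (∀ k → b k ≤± d k) → ∀ n →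
    ∑ n a * ∑ n b - triangle a b n ≤± ∑ n c * ∑ n d - triangle c d n
  product-triangle-≤± {a} {b} {c} {d} a≤±c b≤±d n =
    ≤±-cong (sym (product-triangle a b n)) (sym (product-triangle c d n))
      (∑-≤± n λ {i} _ → ≤±-* (a≤±c i) (∑-tail-≤± b≤±d (ℕ.≤⇒≤′ (ℕ.m∸n≤m n i))))

  triangle≤product : ∀ {a b : ℕ → Carrier} → (∀ k → 0# ≤ a k) → (∀ k → 0# ≤ b k) → ∀ n →
    triangle a b n ≤ ∑ n a * ∑ n b
  triangle≤product {a} {b} 0≤a 0≤b n = ≤-by
    (≤.≤-respˡ-≈ (∑-zero n) (∑-mono n {const 0#} λ {i} _ → 0≤* (0≤a i) (0≤- (monotone (∑-step 0≤b) (ℕ.m∸n≤m n i)))))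
    (sym (product-triangle a b n))
    where
    ∑-zero : ∀ n → ∑ n (const 0#) ≈ 0#
    ∑-zero zero    = refl
    ∑-zero (suc n) = trans (+-identityˡ _) (∑-zero n)

  -- The square i, j < n lies in the triangle i + j < 2 n.
  product≤triangle : ∀ {a b : ℕ → Carrier} → (∀ k → 0# ≤ a k) → (∀ k → 0# ≤ b k) → ∀ n →
    ∑ n a * ∑ n b ≤ triangle a b (n ℕ.+ n)
  product≤triangle {a} {b} 0≤a 0≤b n = begin
    ∑ n a * ∑ n b                                   ≈⟨ ∑-*ʳ n (∑ n b) a ⟩
    ∑ n (λ i → a i * ∑ n b)                         ≤⟨ ∑-mono n (λ {i} i<n → *-monoˡ-≤ (0≤a i) (monotone (∑-step 0≤b) (n≤ i<n))) ⟩
    ∑ n (λ i → a i * ∑ (n ℕ.+ n ℕ.∸ i) b)           ≤⟨ monotone (∑-step λ i → 0≤* (0≤a i) (monotone (∑-step 0≤b) {0} {n ℕ.+ n ℕ.∸ i} ℕ.z≤n)) (ℕ.m≤m+n n n) ⟩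
    triangle a b (n ℕ.+ n)                          ∎
    where
    open ≤-Reasoning
    n≤ : ∀ {i} → i ℕ.< n → n ℕ.≤ n ℕ.+ n ℕ.∸ i
    n≤ {i} i<n = ℕ.≤-trans (ℕ.m≤m+n n (n ℕ.∸ i)) (ℕ.≤-reflexive (≡.sym (ℕ.+-∸-assoc n (ℕ.<⇒≤ i<n))))

  -- Write n + 1 = i + (n + 1 - i) in the summand with index i and absorb each part into its own
  -- factor by `term-suc`; one end term of each sum vanishes. This is the recursion satisfied by
  -- `term (x + y)`, and it takes the place of the binomial theorem.
  convolution-suc : ∀ x y n → fromℕ (suc n) * convolution (term x) (term y) (suc n) ≈ (x + y) * convolution (term x) (term y) n
  convolution-suc x y n = begin
    fromℕ (suc n) * ∑ (2 ℕ.+ n) (λ i → a i * b (suc n ℕ.∸ i))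
      ≈⟨ ∑-*ˡ (2 ℕ.+ n) (fromℕ (suc n)) (λ i → a i * b (suc n ℕ.∸ i)) ⟩
    ∑ (2 ℕ.+ n) (λ i → fromℕ (suc n) * (a i * b (suc n ℕ.∸ i)))
      ≈⟨ ∑-cong (2 ℕ.+ n) (λ {i} i<2+n → trans (*-congʳ (split i<2+n))
           (solve 4 (λ i j a b → (i :+ j) :* (a :* b) := i :* a :* b :+ a :* (j :* b)) refl (fromℕ i) (fromℕ (suc n ℕ.∸ i)) (a i) (b (suc n ℕ.∸ i)))) ⟩
    ∑ (2 ℕ.+ n) (λ i → u i + v i)
      ≈⟨ ∑-+ (2 ℕ.+ n) u v ⟩
    ∑ (2 ℕ.+ n) u + ∑ (2 ℕ.+ n) v
      ≈⟨ +-cong left right ⟩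
    x * convolution a b n + y * convolution a b n
      ≈⟨ distribʳ (convolution a b n) x y ⟨
    (x + y) * convolution a b n ∎
    where
    open ≈-Reasoning
    a b u v : ℕ → Carrier
    a = term x
    b = term y
    u i = fromℕ i * a i * b (suc n ℕ.∸ i)
    v i = a i * (fromℕ (suc n ℕ.∸ i) * b (suc n ℕ.∸ i))
    split : ∀ {i} → i ℕ.< 2 ℕ.+ n → fromℕ (suc n) ≈ fromℕ i + fromℕ (suc n ℕ.∸ i)
    split {i} (ℕ.s≤s i≤1+n) = trans (reflexive (≡.cong fromℕ (≡.sym (ℕ.m+[n∸m]≡n i≤1+n)))) (fromℕ-+ i (suc n ℕ.∸ i))
    left : ∑ (2 ℕ.+ n) u ≈ x * convolution a b n
    left = begin
      u 0 + ∑ (suc n) (u ∘ suc)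
        ≈⟨ +-cong (trans (*-congʳ (zeroˡ (a 0))) (zeroˡ (b (suc n))))
             (∑-cong (suc n) λ {i} _ → trans (*-congʳ (term-suc x i)) (*-assoc x (a i) (b (n ℕ.∸ i)))) ⟩
      0# + ∑ (suc n) (λ i → x * (a i * b (n ℕ.∸ i)))
        ≈⟨ +-identityˡ _ ⟩
      ∑ (suc n) (λ i → x * (a i * b (n ℕ.∸ i)))
        ≈⟨ ∑-*ˡ (suc n) x (λ i → a i * b (n ℕ.∸ i)) ⟨
      x * convolution a b n ∎
    right : ∑ (2 ℕ.+ n) v ≈ y * convolution a b n
    right = begin
      ∑ (2 ℕ.+ n) v
        ≈⟨ ∑-last (suc n) v ⟩
      ∑ (suc n) v + a (suc n) * (fromℕ (n ℕ.∸ n) * b (n ℕ.∸ n))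
        ≈⟨ +-cong
             (∑-cong (suc n) λ {i} i≤n → begin
               a i * (fromℕ (suc n ℕ.∸ i) * b (suc n ℕ.∸ i))
                 ≡⟨ ≡.cong (λ m → a i * (fromℕ m * b m)) (suc-∸ i≤n) ⟩
               a i * (fromℕ (suc (n ℕ.∸ i)) * b (suc (n ℕ.∸ i)))
                 ≈⟨ *-congˡ (term-suc y (n ℕ.∸ i)) ⟩
               a i * (y * b (n ℕ.∸ i))
                 ≈⟨ solve 3 (λ a y b → a :* (y :* b) := y :* (a :* b)) refl (a i) y (b (n ℕ.∸ i)) ⟩
               y * (a i * b (n ℕ.∸ i)) ∎)
             (trans (*-congˡ (trans (*-congʳ (reflexive (≡.cong fromℕ (ℕ.n∸n≡0 n)))) (zeroˡ _))) (zeroʳ (a (suc n)))) ⟩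
      ∑ (suc n) (λ i → y * (a i * b (n ℕ.∸ i))) + 0#
        ≈⟨ +-identityʳ _ ⟩
      ∑ (suc n) (λ i → y * (a i * b (n ℕ.∸ i)))
        ≈⟨ ∑-*ˡ (suc n) y (λ i → a i * b (n ℕ.∸ i)) ⟨
      y * convolution a b n ∎

  convolution-term : ∀ x y n → convolution (term x) (term y) n ≈ term (x + y) n
  convolution-term x y zero = begin
    term x 0 * term y 0 + 0#  ≈⟨ +-identityʳ _ ⟩
    term x 0 * term y 0       ≈⟨ *-cong (term-zero x) (term-zero y) ⟩
    1# * 1#                   ≈⟨ *-identityʳ 1# ⟩
    1#                        ≈⟨ term-zero (x + y) ⟨
    term (x + y) 0            ∎
    where open ≈-Reasoning
  convolution-term x y (suc n) = *-cancelˡ-≈ (0<fromℕ (suc n)) (trans (convolution-suc x y n)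
    (trans (*-congˡ (convolution-term x y n)) (sym (term-suc (x + y) n))))

  triangle-⟶ : ∀ x y → triangle (term x) (term y) ⟶ exp (x + y)
  triangle-⟶ x y = ⟶-cong {s = expSum (x + y)}
    (λ n → sym (trans (triangle≈∑ (term x) (term y) n) (∑-cong n λ {i} _ → convolution-term x y i))) refl (expSum-⟶ (x + y))

  product-⟶ : ∀ x y → (λ n → expSum x n * expSum y n) ⟶ exp x * exp y
  product-⟶ x y = ⟶-* (expSum-⟶ x) (expSum-⟶ y)

  exp-+-nonneg : ∀ {x y} → 0# ≤ x → 0# ≤ y → exp (x + y) ≈ exp x * exp y
  exp-+-nonneg {x} {y} 0≤x 0≤y = ≤.antisym
    (⟶-≤ (always (triangle≤product (0≤term 0≤x) (0≤term 0≤y))) (triangle-⟶ x y) (product-⟶ x y))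
    (⟶-≤ (always (product≤triangle (0≤term 0≤x) (0≤term 0≤y))) (product-⟶ x y)
      (⟶-subsequence (λ n → n ℕ.+ n) (λ n → ℕ.m≤m+n n n) (triangle-⟶ x y)))

  exp-+ : ∀ x y → exp (x + y) ≈ exp x * exp y
  exp-+ x y = ⟶-unique (⟶-cong {s = λ n → triangle (term x) (term y) n + (expSum x n * expSum y n - triangle (term x) (term y) n)}
      (λ n → solve 2 (λ p t → t :+ (p :- t) := p) refl (expSum x n * expSum y n) (triangle (term x) (term y) n))
      (+-identityʳ (exp (x + y)))
      (⟶-+ (triangle-⟶ x y) (null⇒⟶ (null-cong (λ n → solve 1 (λ z → z := z :- :0) refl (expSum x n * expSum y n - triangle (term x) (term y) n)) gap))))
    (product-⟶ x y)
    where
    u = proj₁ (≤±-exists x)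
    v = proj₁ (≤±-exists y)
    0≤u = proj₁ (proj₁ (proj₂ (≤±-exists x)))
    0≤v = proj₁ (proj₁ (proj₂ (≤±-exists y)))
    gap′ : Null (λ n → expSum u n * expSum v n - triangle (term u) (term v) n)
    gap′ = null-cong (λ n → solve 3 (λ p t l → (p :- l) :+ :- :1 :* (t :- l) := p :- t) refl
          (expSum u n * expSum v n) (triangle (term u) (term v) n) (exp (u + v)))
      (null-+ (⟶⇒null (⟶-cong (λ _ → refl) (sym (exp-+-nonneg 0≤u 0≤v)) (product-⟶ u v)))
        (const-*-null (- 1#) (⟶⇒null (triangle-⟶ u v))))
    gap : Null (λ n → expSum x n * expSum y n - triangle (term x) (term y) n)
    gap = null-dominated (always (product-triangle-≤± (term-≤± (proj₂ (proj₂ (≤±-exists x)))) (term-≤± (proj₂ (proj₂ (≤±-exists y)))))) gap′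

  -- Monotonicity and numerical bounds for exp

  1+x≤exp : ∀ {x} → 0# ≤ x → 1# + x ≤ exp x
  1+x≤exp {x} 0≤x = begin
    1# + x                           ≈⟨ +-cong (term-zero x) term-one ⟨
    term x 0 + term x 1              ≈⟨ +-congˡ (+-identityʳ (term x 1)) ⟨
    expSum x 2                       ≤⟨ expSum≤exp 0≤x 2 ⟩
    exp x                            ∎
    where
    open ≤-Reasoning
    term-one : term x 1 ≈ x
    term-one = trans (trans (sym (*-identityˡ (term x 1))) (*-congʳ (sym fromℕ-1)))
      (trans (term-suc x 0) (trans (*-congˡ (term-zero x)) (*-identityʳ x)))

  1≤exp : ∀ {x} → 0# ≤ x → 1# ≤ exp x
  1≤exp {x} 0≤x = ≤.trans (≤-by 0≤x (solve 1 (λ x → x := (:1 :+ x) :- :1) refl x)) (1+x≤exp 0≤x)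

  0<exp-nonneg : ∀ {x} → 0# ≤ x → 0# < exp x
  0<exp-nonneg 0≤x = Strict.<-≤-trans sym ≤.trans ≤.antisym ≤.≤-respʳ-≈ 0<1 (1≤exp 0≤x)

  exp-0 : exp 0# ≈ 1#
  exp-0 = *-cancelˡ-≈ (0<exp-nonneg ≤.refl) (begin
    exp 0# * exp 0#  ≈⟨ exp-+ 0# 0# ⟨
    exp (0# + 0#)    ≈⟨ exp-cong (+-identityˡ 0#) ⟩
    exp 0#           ≈⟨ *-identityʳ (exp 0#) ⟨
    exp 0# * 1#      ∎)
    where open ≈-Reasoning

  exp-inverse : ∀ x → exp x * exp (- x) ≈ 1#
  exp-inverse x = trans (sym (exp-+ x (- x))) (trans (exp-cong (-‿inverseʳ x)) exp-0)

  0<exp : ∀ x → 0# < exp x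
  0<exp x with ≤.total 0# x
  ... | inj₁ 0≤x = 0<exp-nonneg 0≤x
  ... | inj₂ x≤0 = ≰⇒> λ ex≤0 → <⇒≱ 0<1 (begin
    1#                  ≈⟨ exp-inverse x ⟨
    exp x * exp (- x)   ≤⟨ *-monoʳ-≤ (proj₁ (0<exp-nonneg 0≤-x)) ex≤0 ⟩
    0# * exp (- x)      ≈⟨ zeroˡ (exp (- x)) ⟩
    0#                  ∎)
    where
    open ≤-Reasoning
    0≤-x : 0# ≤ - x
    0≤-x = ≤-by (0≤- x≤0) (solve 1 (λ x → :0 :- x := :- x :- :0) refl x)

  exp-shift : ∀ x y → exp y ≈ exp x * exp (y - x)
  exp-shift x y = trans (exp-cong (solve 2 (λ x y → y := x :+ (y :- x)) refl x y)) (exp-+ x (y - x))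

  exp-mono-≤ : ∀ {x y} → x ≤ y → exp x ≤ exp y
  exp-mono-≤ {x} {y} x≤y = begin
    exp x                ≈⟨ *-identityʳ (exp x) ⟨
    exp x * 1#           ≤⟨ *-monoˡ-≤ (proj₁ (0<exp x)) (1≤exp (0≤- x≤y)) ⟩
    exp x * exp (y - x)  ≈⟨ exp-shift x y ⟨
    exp y                ∎
    where open ≤-Reasoning

  exp-cancel-≤ : ∀ {x y} → exp x ≤ exp y → x ≤ y
  exp-cancel-≤ {x} {y} ex≤ey = ≮⇒≥ λ y<x → <⇒≱ (0<- y<x) (≤-by
    (0≤- (*-cancelˡ-≤ (0<exp y) (begin
      exp y * (1# + (x - y))  ≤⟨ *-monoˡ-≤ (proj₁ (0<exp y)) (1+x≤exp (proj₁ (0<- y<x))) ⟩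
      exp y * exp (x - y)     ≈⟨ exp-shift y x ⟨
      exp x                   ≤⟨ ex≤ey ⟩
      exp y                   ≈⟨ *-identityʳ (exp y) ⟨
      exp y * 1#              ∎)))
    (solve 2 (λ x y → :1 :- (:1 :+ (x :- y)) := :0 :- (x :- y)) refl x y))
    where open ≤-Reasoning

  -- The first five terms at 3 are 1 + 3 + 9/2 + 9/2 + 27/8 = 131/8.
  16≤exp[3] : fromℕ 16 ≤ exp (fromℕ 3)
  16≤exp[3] = ≤.trans (*-cancelˡ-≤ (0<fromℕ 8) (begin
    fromℕ 8 * fromℕ 16    ≈⟨ fromℕ-* 8 16 ⟨
    fromℕ 128             ≤⟨ fromℕ-mono (ℕ.≤ᵇ⇒≤ 128 131 _) ⟩
    fromℕ 131             ≈⟨ eight ⟨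
    fromℕ 8 * expSum (fromℕ 3) 5 ∎)) (expSum≤exp (0≤fromℕ 3) 5)
    where
    open ≤-Reasoning
    t : ℕ → Carrier
    t = term (fromℕ 3)
    t₁ : t 1 ≈ fromℕ 3
    t₁ = trans (trans (sym (*-identityˡ (t 1))) (*-congʳ (sym fromℕ-1)))
      (trans (term-suc (fromℕ 3) 0) (trans (*-congˡ (term-zero (fromℕ 3))) (*-identityʳ (fromℕ 3))))
    2t₂ : fromℕ 2 * t 2 ≈ fromℕ 9
    2t₂ = trans (term-suc (fromℕ 3) 1) (trans (*-congˡ t₁) (sym (fromℕ-* 3 3)))
    t₃ : t 3 ≈ t 2
    t₃ = *-cancelˡ-≈ (0<fromℕ 3) (term-suc (fromℕ 3) 2)
    4t₄ : fromℕ 4 * t 4 ≈ fromℕ 3 * t 2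
    4t₄ = trans (term-suc (fromℕ 3) 3) (*-congˡ t₃)
    eight : fromℕ 8 * expSum (fromℕ 3) 5 ≈ fromℕ 131
    eight = begin-equality
      fromℕ 8 * (t 0 + (t 1 + (t 2 + (t 3 + (t 4 + 0#)))))
        ≈⟨ solve 5 (λ a b c d e → con (8 , 0) :* (a :+ (b :+ (c :+ (d :+ (e :+ :0))))) :=
                   con (8 , 0) :* a :+ con (8 , 0) :* b :+ con (8 , 0) :* c :+ con (8 , 0) :* d :+ con (2 , 0) :* (con (4 , 0) :* e)) refl (t 0) (t 1) (t 2) (t 3) (t 4) ⟩
      fromℕ 8 * t 0 + fromℕ 8 * t 1 + fromℕ 8 * t 2 + fromℕ 8 * t 3 + fromℕ 2 * (fromℕ 4 * t 4)
        ≈⟨ +-cong (+-cong (+-congʳ (+-cong (*-congˡ (term-zero (fromℕ 3))) (*-congˡ t₁))) (*-congˡ t₃)) (*-congˡ 4t₄) ⟩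
      fromℕ 8 * 1# + fromℕ 8 * fromℕ 3 + fromℕ 8 * t 2 + fromℕ 8 * t 2 + fromℕ 2 * (fromℕ 3 * t 2)
        ≈⟨ solve 1 (λ c → con (8 , 0) :* :1 :+ con (8 , 0) :* con (3 , 0) :+ con (8 , 0) :* c :+ con (8 , 0) :* c :+ con (2 , 0) :* (con (3 , 0) :* c)
                   := con (32 , 0) :+ con (11 , 0) :* (con (2 , 0) :* c)) refl (t 2) ⟩
      fromℕ 32 + fromℕ 11 * (fromℕ 2 * t 2)
        ≈⟨ +-congˡ (*-congˡ 2t₂) ⟩
      fromℕ 32 + fromℕ 11 * fromℕ 9
        ≈⟨ trans (fromℕ-+ 32 99) (+-congˡ (fromℕ-* 11 9)) ⟨
      fromℕ 131 ∎

  16^≤exp : ∀ n → fromℕ (16 ℕ.^ n) ≤ exp (fromℕ (3 ℕ.* n))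
  16^≤exp zero    = ≤.trans (≤.reflexive fromℕ-1) (1≤exp (0≤fromℕ 0))
  16^≤exp (suc n) = begin
    fromℕ (16 ℕ.* 16 ℕ.^ n)                   ≈⟨ fromℕ-* 16 (16 ℕ.^ n) ⟩
    fromℕ 16 * fromℕ (16 ℕ.^ n)               ≤⟨ *-mono-≤ (0≤fromℕ (16 ℕ.^ n)) (proj₁ (0<exp (fromℕ 3))) 16≤exp[3] (16^≤exp n) ⟩
    exp (fromℕ 3) * exp (fromℕ (3 ℕ.* n))     ≈⟨ exp-+ (fromℕ 3) (fromℕ (3 ℕ.* n)) ⟨
    exp (fromℕ 3 + fromℕ (3 ℕ.* n))           ≈⟨ exp-cong (fromℕ-+ 3 (3 ℕ.* n)) ⟨
    exp (fromℕ (3 ℕ.+ 3 ℕ.* n))               ≡⟨ ≡.cong (exp ∘ fromℕ) (ℕ.*-suc 3 n) ⟨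
    exp (fromℕ (3 ℕ.* suc n))                 ∎
    where open ≤-Reasoning

  -- The root exists because exp (x / 2) is one.
  sqrt-exp : ∀ x → 0# ≤ sqrt (exp x) × sqrt (exp x) * sqrt (exp x) ≈ exp x
  sqrt-exp x = the-spec {λ r → 0# ≤ r × r * r ≈ exp x} (exp h , proj₁ (0<exp h) , trans (sym (exp-+ h h)) (exp-cong h+h≈x))
    where
    i = proj₁ (invert 0<2)
    h = i * x
    h+h≈x : h + h ≈ x
    h+h≈x = trans (solve 2 (λ i x → i :* x :+ i :* x := (i :* (:1 :+ :1)) :* x) refl i x)
      (trans (*-congʳ (proj₂ (proj₂ (invert 0<2)))) (*-identityˡ x))

  -- Comparison of densities

  proportion≥-* : ∀ (f g : ℕ → Carrier) {t u} m → .{{ℕ.NonZero m}} →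
    (∀ n → .{{ℕ.NonZero n}} → t ≤ f n → u ≤ g (n ℕ.* m)) → ∀ N → .{{ℕ.NonZero N}} →
    proportion≥ f t N ≤ fromℕ m * proportion≥ g u (N ℕ.* m)
  proportion≥-* f g {t} {u} m t⇒u N = *-cancelˡ-≤ (0<fromℕ N) (begin
    fromℕ N * proportion≥ f t N       ≈⟨ *-comm (fromℕ N) (proportion≥ f t N) ⟩
    proportion≥ f t N * fromℕ N       ≈⟨ /-* _ (0<fromℕ N) ⟩
    fromℕ (length (filter (λ n → em {t ≤ f n}) [1… N ]))
      ≤⟨ fromℕ-mono (length-filter-* (λ n → em {t ≤ f n}) (λ n → em {u ≤ g n}) m t⇒u N) ⟩
    fromℕ (length (filter (λ n → em {u ≤ g n}) [1… N ℕ.* m ]))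
      ≈⟨ /-* _ (0<fromℕ (N ℕ.* m) {{Nm≢0}}) ⟨
    p * fromℕ (N ℕ.* m)               ≈⟨ *-congˡ (fromℕ-* N m) ⟩
    p * (fromℕ N * fromℕ m)           ≈⟨ solve 3 (λ p N m → p :* (N :* m) := N :* (m :* p)) refl p (fromℕ N) (fromℕ m) ⟩
    fromℕ N * (fromℕ m * p)           ∎)
    where
    open ≤-Reasoning
    p = proportion≥ g u (N ℕ.* m)
    Nm≢0 : ℕ.NonZero (N ℕ.* m)
    Nm≢0 = ℕ.m*n≢0 N m {{ℕ.>-nonZero (ℕ.>-nonZero⁻¹ N)}} {{ℕ.>-nonZero (ℕ.>-nonZero⁻¹ m)}}

  -- The injection n ↦ n m carries the integers up to N into those up to N m, a range m times as
  -- long; hence the factor m.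
  density-* : ∀ (f g : ℕ → Carrier) {t u a b} m → .{{ℕ.NonZero m}} →
    (∀ n → .{{ℕ.NonZero n}} → t ≤ f n → u ≤ g (n ℕ.* m)) →
    proportion≥ f t ⟶ a → proportion≥ g u ⟶ b → a ≤ fromℕ m * b
  density-* f g {t} {u} m t⇒u f⟶a g⟶b = ⟶-≤ {s = proportion≥ f t} {t = λ N → fromℕ m * proportion≥ g u (N ℕ.* m)}
    (1 , λ N 1≤N → proportion≥-* f g m t⇒u N {{ℕ.>-nonZero 1≤N}})
    f⟶a (⟶-*ˡ (fromℕ m) (⟶-subsequence {s = proportion≥ g u} (ℕ._* m) (λ N → ℕ.m≤m*n N m) g⟶b))

  -- The set of all positive integers, written as a superlevel set so that `density-*` can compare
  -- it with another one.
  proportion≥-const : ∀ t → proportion≥ (const t) t ⟶ 1#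
  proportion≥-const t ε 0<ε = 1 , λ N 1≤N →
    let p≈1 = proportion≈1 N {{ℕ.>-nonZero 1≤N}} in
    <-by 0<ε (trans (solve 2 (λ p e → e := p :- (p :- e)) refl (proportion≥ (const t) t N) ε) (+-congˡ (-‿cong (+-congʳ p≈1)))) ,
    <-by 0<ε (trans (solve 2 (λ p e → e := (p :+ e) :- p) refl (proportion≥ (const t) t N) ε) (+-congʳ (+-congʳ p≈1)))
    where
    open ≈-Reasoning
    proportion≈1 : ∀ N → .{{ℕ.NonZero N}} → proportion≥ (const t) t N ≈ 1#
    proportion≈1 N = *-cancelˡ-≈ (0<fromℕ N) (begin
      fromℕ N * proportion≥ (const t) t N       ≈⟨ *-comm (fromℕ N) (proportion≥ (const t) t N) ⟩
      proportion≥ (const t) t N * fromℕ N       ≈⟨ /-* _ (0<fromℕ N) ⟩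
      fromℕ (length (filter (λ n → em {t ≤ t}) [1… N ]))
        ≡⟨ ≡.cong (fromℕ ∘ length) (filter-all (λ n → em {t ≤ t}) {[1… N ]} (tabulate λ _ → ≤.refl)) ⟩
      fromℕ (length [1… N ])                    ≡⟨ ≡.cong fromℕ (length-applyUpTo suc N) ⟩
      fromℕ N                                   ≈⟨ *-identityʳ (fromℕ N) ⟨
      fromℕ N * 1#                              ∎)

  -- Rounding √y, and abundancy over the reals

  even-floor : ∀ {s} Q → fromℕ (2 ℕ.* Q) ≤ s →
    ∃ λ q → Q ℕ.≤ q × fromℕ (2 ℕ.* q) ≤ s × s ≤ fromℕ (2 ℕ.* suc q)
  even-floor {s} Q 2Q≤s = descend n (≤.trans s≤n (fromℕ-mono (ℕ.≤-trans (ℕ.m≤n+m n Q) (ℕ.m≤n*m (Q ℕ.+ n) 2))))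
    where
    n = proj₁ (archimedean s)
    s≤n = proj₂ (archimedean s)
    descend : ∀ j → s ≤ fromℕ (2 ℕ.* (Q ℕ.+ j)) → ∃ λ q → Q ℕ.≤ q × fromℕ (2 ℕ.* q) ≤ s × s ≤ fromℕ (2 ℕ.* suc q)
    descend zero    s≤ = Q , ℕ.≤-refl , 2Q≤s , ≤.trans s≤
      (fromℕ-mono (ℕ.*-monoʳ-≤ 2 (ℕ.≤-trans (ℕ.≤-reflexive (ℕ.+-identityʳ Q)) (ℕ.n≤1+n Q))))
    descend (suc j) s≤ with ≤.total s (fromℕ (2 ℕ.* (Q ℕ.+ j)))
    ... | inj₁ s≤′ = descend j s≤′
    ... | inj₂ ≤s  = Q ℕ.+ j , ℕ.m≤m+n Q j , ≤s , ≤.trans s≤ (≤.reflexive (reflexive (≡.cong (λ m → fromℕ (2 ℕ.* m)) (ℕ.+-suc Q j))))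

  σ/n n/φ : ℕ → Carrier
  σ/n n = fromℕ (σ n) / fromℕ n
  n/φ n = fromℕ n / fromℕ (φ n)

  σ/n≤n/φ : ∀ {t} n → .{{ℕ.NonZero n}} → t ≤ σ/n n → t ≤ n/φ n
  σ/n≤n/φ {t} n t≤σ/n = ≤/ 0<φ (*-cancelˡ-≤ 0<n (begin
    fromℕ n * (t * fromℕ (φ n))  ≈⟨ solve 3 (λ n t p → n :* (t :* p) := p :* (t :* n)) refl (fromℕ n) t (fromℕ (φ n)) ⟩
    fromℕ (φ n) * (t * fromℕ n)  ≤⟨ *-monoˡ-≤ (proj₁ 0<φ) (≤/⁻ 0<n t≤σ/n) ⟩
    fromℕ (φ n) * fromℕ (σ n)    ≈⟨ fromℕ-* (φ n) (σ n) ⟨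
    fromℕ (φ n ℕ.* σ n)          ≤⟨ fromℕ-mono (φ*σ≤m*m n) ⟩
    fromℕ (n ℕ.* n)              ≈⟨ fromℕ-* n n ⟩
    fromℕ n * fromℕ n            ∎))
    where
    open ≤-Reasoning
    0<n : 0# < fromℕ n
    0<n = 0<fromℕ n
    0<φ : 0# < fromℕ (φ n)
    0<φ = 0<fromℕ (φ n) {{φ≢0 n}}

  -- With D = 6 k (q + 1), the relative loss 5 / D costs 5 t / D ≤ w at height t. As n / φ(n) may
  -- exceed t, it is first lowered to t, which is allowed because D ≥ 5 makes the factor 1 - 5 / D
  -- nonnegative.
  σ/n-multiplier : ∀ {q k M t w} → IsMultiplier q k M → fromℕ 5 * t ≤ fromℕ (6 ℕ.* k ℕ.* suc q) * w →
    ∀ n → .{{ℕ.NonZero n}} → t ≤ n/φ n → t - w ≤ σ/n (n ℕ.* M)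
  σ/n-multiplier {q} {k} {M} {t} {w} isM 5t≤Dw n t≤n/φ = ≤/ 0<m (*-cancelˡ-≤ 0<D (*-cancelˡ-≤ 0<φ (≤-by
    (0≤+ (0≤+ (0≤- σ≥′) (0≤* (0≤* (proj₁ 0<φ) (proj₁ 0<m)) (0≤- 5t≤Dw))) (0≤* (0≤* 0≤D-5 (proj₁ 0<m)) (0≤- (≤/⁻ 0<φ t≤n/φ))))
    (solve 7 (λ p m D t w n s →
       (((D :* (p :* s) :+ con (5 , 0) :* (n :* m)) :- D :* (n :* m)) :+ (p :* m) :* (D :* w :- con (5 , 0) :* t)) :+ ((D :- con (5 , 0)) :* m) :* (n :- t :* p)
       := p :* (D :* s) :- p :* (D :* ((t :- w) :* m))) refl (fromℕ (φ n)) (fromℕ m) (fromℕ D) t w (fromℕ n) (fromℕ (σ m))))))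
    where
    open ≤-Reasoning
    open IsMultiplier isM
    m = n ℕ.* M
    D = 6 ℕ.* k ℕ.* suc q
    instance
      n≢0′ : ℕ.NonZero n
      n≢0′ = ℕ.>-nonZero (ℕ.>-nonZero⁻¹ n)
    0<m : 0# < fromℕ m
    0<m = 0<fromℕ m {{ℕ.m*n≢0 n M {{n≢0′}} {{M≢0}}}}
    0<φ : 0# < fromℕ (φ n)
    0<φ = 0<fromℕ (φ n) {{φ≢0 n}}
    5≤D : 5 ℕ.≤ D
    5≤D = ℕ.≤-trans (ℕ.≤ᵇ⇒≤ 5 6 _) (ℕ.≤-trans (ℕ.m≤m*n 6 k {{k≢0}}) (ℕ.m≤m*n (6 ℕ.* k) (suc q)))
    0<D : 0# < fromℕ D
    0<D = 0<fromℕ D {{ℕ.>-nonZero (ℕ.≤-trans (ℕ.s≤s ℕ.z≤n) 5≤D)}}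
    0≤D-5 : 0# ≤ fromℕ D - fromℕ 5
    0≤D-5 = 0≤- (fromℕ-mono 5≤D)
    σ≥′ : fromℕ D * (fromℕ n * fromℕ m) ≤ fromℕ D * (fromℕ (φ n) * fromℕ (σ m)) + fromℕ 5 * (fromℕ n * fromℕ m)
    σ≥′ = begin
      fromℕ D * (fromℕ n * fromℕ m)                         ≈⟨ *-congˡ (fromℕ-* n m) ⟨
      fromℕ D * fromℕ (n ℕ.* m)                             ≈⟨ fromℕ-* D (n ℕ.* m) ⟨
      fromℕ (D ℕ.* (n ℕ.* m))                               ≤⟨ fromℕ-mono (σ≥ n) ⟩
      fromℕ (D ℕ.* (φ n ℕ.* σ m) ℕ.+ 5 ℕ.* (n ℕ.* m))       ≈⟨ fromℕ-+ (D ℕ.* (φ n ℕ.* σ m)) (5 ℕ.* (n ℕ.* m)) ⟩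
      fromℕ (D ℕ.* (φ n ℕ.* σ m)) + fromℕ (5 ℕ.* (n ℕ.* m)) ≈⟨ +-cong (trans (fromℕ-* D (φ n ℕ.* σ m)) (*-congˡ (fromℕ-* (φ n) (σ m))))
                                                                       (trans (fromℕ-* 5 (n ℕ.* m)) (*-congˡ (fromℕ-* n m))) ⟩
      fromℕ D * (fromℕ (φ n) * fromℕ (σ m)) + fromℕ 5 * (fromℕ n * fromℕ m) ∎

  σ/n-unbounded : ∀ t → ∃ λ m → ℕ.NonZero m × (∀ n → .{{ℕ.NonZero n}} → t ≤ σ/n (n ℕ.* m))
  σ/n-unbounded t =
    let j , t≤j = archimedean t
        m , m≢0 , jnm≤σ = abundant j
    in m , m≢0 , λ n → ≤/ (0<fromℕ (n ℕ.* m) {{ℕ.m*n≢0 n m {{ℕ.>-nonZero (ℕ.>-nonZero⁻¹ n)}} {{m≢0}}}}) (begin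
      t * fromℕ (n ℕ.* m)         ≤⟨ *-monoʳ-≤ (0≤fromℕ (n ℕ.* m)) t≤j ⟩
      fromℕ j * fromℕ (n ℕ.* m)   ≈⟨ fromℕ-* j (n ℕ.* m) ⟨
      fromℕ (j ℕ.* (n ℕ.* m))     ≤⟨ fromℕ-mono (jnm≤σ n) ⟩
      fromℕ (σ (n ℕ.* m))         ∎)
    where open ≤-Reasoning

  -- The two inequalities for A and B

  module _ (A-convergent : ∀ t → Convergent (proportionσ t)) (B-convergent : ∀ t → Convergent (proportionφ t)) where

    A-⟶ : ∀ t → proportionσ t ⟶ A t
    A-⟶ t = the-spec {proportionσ t ⟶_} (A-convergent t)

    B-⟶ : ∀ t → proportionφ t ⟶ B t
    B-⟶ t = the-spec {proportionφ t ⟶_} (B-convergent t)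

    A≤B : ∀ t → A t ≤ B t
    A≤B t = begin
      A t             ≤⟨ density-* σ/n n/φ 1 (λ n t≤ → ≡.subst (λ m → t ≤ n/φ m) (≡.sym (ℕ.*-identityʳ n)) (σ/n≤n/φ n t≤)) (A-⟶ t) (B-⟶ t) ⟩
      fromℕ 1 * B t   ≈⟨ trans (*-congʳ fromℕ-1) (*-identityˡ (B t)) ⟩
      B t             ∎
      where open ≤-Reasoning

    -- All multiples of some fixed m have abundancy index at least t, so A t is at least 1 / m.
    0<A : ∀ t → 0# < A t
    0<A t = let m , m≢0 , t≤σ/n = σ/n-unbounded t in ≰⇒> λ A≤0 → <⇒≱ 0<1 (begin
      1#              ≤⟨ density-* (const 0#) σ/n m {{m≢0}} (λ n _ → t≤σ/n n) (proportion≥-const 0#) (A-⟶ t) ⟩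
      fromℕ m * A t   ≤⟨ *-monoˡ-≤ (0≤fromℕ m) A≤0 ⟩
      fromℕ m * 0#    ≈⟨ zeroʳ (fromℕ m) ⟩
      0#              ∎)
      where open ≤-Reasoning

    -- The variables L, g and s stand for log y, exp γ and √y.
    module _ {t g L s : Carrier} (0<g : 0# < g) (t≈ : t ≈ L * g) (0≤s : 0# ≤ s) (s² : s * s ≈ exp L)
             {q k M : ℕ} (isM : IsMultiplier q k M)
             (2q≤s : fromℕ (2 ℕ.* q) ≤ s) (s≤2q+2 : s ≤ fromℕ (2 ℕ.* suc q)) where
      open IsMultiplier isM

      0<s : 0# < s
      0<s = ≰⇒> λ s≤0 → <⇒≱ (0<exp L) (begin
        exp L    ≈⟨ s² ⟨
        s * s    ≤⟨ *-monoˡ-≤ 0≤s s≤0 ⟩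
        s * 0#   ≈⟨ zeroʳ s ⟩
        0#       ∎)
        where open ≤-Reasoning

      -- From √y ≤ 2 (q + 1) ≤ 4^k follows y ≤ 16^k, so 16 ≤ e³ is used here a second time.
      L≤3k : L ≤ fromℕ (3 ℕ.* k)
      L≤3k = exp-cancel-≤ (begin
        exp L                              ≈⟨ s² ⟨
        s * s                              ≤⟨ *-mono-≤ 0≤s (0≤fromℕ (4 ℕ.^ k)) s≤4^k s≤4^k ⟩
        fromℕ (4 ℕ.^ k) * fromℕ (4 ℕ.^ k)  ≈⟨ fromℕ-* (4 ℕ.^ k) (4 ℕ.^ k) ⟨
        fromℕ (4 ℕ.^ k ℕ.* 4 ℕ.^ k)        ≡⟨ ≡.cong fromℕ 16^≡ ⟨
        fromℕ (16 ℕ.^ k)                   ≤⟨ 16^≤exp k ⟩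
        exp (fromℕ (3 ℕ.* k))              ∎)
        where
        open ≤-Reasoning
        16^≡ : 16 ℕ.^ k ≡ 4 ℕ.^ k ℕ.* 4 ℕ.^ k
        16^≡ = ≡.trans (ℕ.^-*-assoc 4 2 k) (≡.trans (ℕ.^-distribˡ-+-* 4 k (k ℕ.+ 0))
          (≡.cong (λ l → 4 ℕ.^ k ℕ.* 4 ℕ.^ l) (ℕ.+-identityʳ k)))
        s≤4^k : s ≤ fromℕ (4 ℕ.^ k)
        s≤4^k = ≤.trans s≤2q+2 (fromℕ-mono 2q+2≤)

      M<exp[3s] : fromℕ M < exp (fromℕ 3 * s)
      M<exp[3s] = begin-strict
        fromℕ M                               <⟨ fromℕ-mono-< M<16^ ⟩
        fromℕ (16 ℕ.^ (2 ℕ.* q))              ≤⟨ 16^≤exp (2 ℕ.* q) ⟩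
        exp (fromℕ (3 ℕ.* (2 ℕ.* q)))         ≤⟨ exp-mono-≤ (≤.trans (≤.reflexive (fromℕ-* 3 (2 ℕ.* q))) (*-monoˡ-≤ (0≤fromℕ 3) 2q≤s)) ⟩
        exp (fromℕ 3 * s)                     ∎
        where open ≤-Reasoning

      w : Carrier
      w = (fromℕ 5 * g) / s

      ws : w * s ≈ fromℕ 5 * g
      ws = /-* (fromℕ 5 * g) 0<s

      0≤w : 0# ≤ w
      0≤w = ≤/ 0<s (≤.trans (≤.reflexive (zeroˡ s)) (0≤* (0≤fromℕ 5) (proj₁ 0<g)))

      -- This explains 6 k (q + 1) in `IsMultiplier`: it is the product of the upper bounds 3 k for
      -- log y and 2 (q + 1) for √y, while 5 t = 5 L g = L (w s).
      5t≤Dw : fromℕ 5 * t ≤ fromℕ (6 ℕ.* k ℕ.* suc q) * w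
      5t≤Dw = begin
        fromℕ 5 * t                                      ≈⟨ *-congˡ t≈ ⟩
        fromℕ 5 * (L * g)                            ≈⟨ solve 2 (λ l g → con (5 , 0) :* (l :* g) := l :* (con (5 , 0) :* g)) refl L g ⟩
        L * (fromℕ 5 * g)                            ≈⟨ *-congˡ ws ⟨
        L * (w * s)                                      ≤⟨ *-mono-≤ (0≤* 0≤w 0≤s) (0≤fromℕ (3 ℕ.* k)) L≤3k (*-monoˡ-≤ 0≤w s≤2q+2) ⟩
        fromℕ (3 ℕ.* k) * (w * fromℕ (2 ℕ.* suc q))      ≈⟨ solve 3 (λ a b w → a :* (w :* b) := (a :* b) :* w) refl (fromℕ (3 ℕ.* k)) (fromℕ (2 ℕ.* suc q)) w ⟩
        fromℕ (3 ℕ.* k) * fromℕ (2 ℕ.* suc q) * w        ≈⟨ *-congʳ (fromℕ-* (3 ℕ.* k) (2 ℕ.* suc q)) ⟨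
        fromℕ (3 ℕ.* k ℕ.* (2 ℕ.* suc q)) * w            ≡⟨ ≡.cong (λ d → fromℕ d * w) (lemma k (suc q)) ⟩
        fromℕ (6 ℕ.* k ℕ.* suc q) * w                    ∎
        where
        open ≤-Reasoning
        lemma : ∀ k r → 3 ℕ.* k ℕ.* (2 ℕ.* r) ≡ 6 ℕ.* k ℕ.* r
        lemma = solve-∀

      B<exp*A : B t < exp (fromℕ 3 * s) * A (t - (fromℕ 5 * g) / s)
      B<exp*A = begin-strict
        B t                             ≤⟨ density-* n/φ σ/n M {{M≢0}} (λ n → σ/n-multiplier isM 5t≤Dw n) (B-⟶ t) (A-⟶ (t - w)) ⟩
        fromℕ M * A (t - w)             ≈⟨ *-comm (fromℕ M) (A (t - w)) ⟩
        A (t - w) * fromℕ M             <⟨ *-monoˡ-< (0<A (t - w)) M<exp[3s] ⟩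
        A (t - w) * exp (fromℕ 3 * s)   ≈⟨ *-comm (A (t - w)) (exp (fromℕ 3 * s)) ⟩
        exp (fromℕ 3 * s) * A (t - w)   ∎
        where open ≤-Reasoning

    -- Equations for s, y, L, e and g instead of their values, which as nested limits
    -- are too large to be compared by unfolding.
    B<exp*A-eventually : ∀ {Q} → (∀ q → Q ℕ.≤ q → ∃₂ (IsMultiplier q)) →
      ∀ {t s y L e z x g} → s ≡ sqrt y → y ≡ exp L → L ≡ t * e → e ≡ exp z → z ≡ - x → g ≡ exp x →
      fromℕ (2 ℕ.* Q) * fromℕ (2 ℕ.* Q) * g ≤ t →
      B t < exp (fromℕ 3 * s) * A (t - (fromℕ 5 * g) / s)
    B<exp*A-eventually {Q} multipliers {t} {s} {y} {L} {e} {z} {x} {g} s≡ y≡ L≡ e≡ z≡ g≡ c²g≤t =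
      B<exp*A 0<g t≈Lg 0≤s s² isM 2q≤s s≤
      where
      open ≤-Reasoning
      c : Carrier
      c = fromℕ (2 ℕ.* Q)
      0<g : 0# < g
      0<g = ≡.subst (0# <_) (≡.sym g≡) (0<exp x)
      sqrt-y : 0# ≤ s × s * s ≈ exp L
      sqrt-y = ≡.subst (λ r → 0# ≤ r × r * r ≈ exp L) (≡.sym (≡.trans s≡ (≡.cong sqrt y≡))) (sqrt-exp L)
      0≤s : 0# ≤ s
      0≤s = proj₁ sqrt-y
      s² : s * s ≈ exp L
      s² = proj₂ sqrt-y
      ge≈1 : g * e ≈ 1#
      ge≈1 = trans (*-cong (reflexive g≡) (trans (reflexive e≡) (exp-cong (reflexive z≡)))) (exp-inverse x)
      t≈Lg : t ≈ L * g
      t≈Lg = begin-equality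
        t            ≈⟨ *-identityʳ t ⟨
        t * 1#       ≈⟨ *-congˡ ge≈1 ⟨
        t * (g * e)  ≈⟨ solve 3 (λ t g e → t :* (g :* e) := t :* e :* g) refl t g e ⟩
        t * e * g    ≈⟨ *-congʳ (reflexive L≡) ⟨
        L * g        ∎
      c²≤L : c * c ≤ L
      c²≤L = *-cancelˡ-≤ 0<g (begin
        g * (c * c)  ≈⟨ *-comm g (c * c) ⟩
        c * c * g    ≤⟨ c²g≤t ⟩
        t            ≈⟨ t≈Lg ⟩
        L * g        ≈⟨ *-comm L g ⟩
        g * L        ∎)
      0≤L : 0# ≤ L
      0≤L = ≤.trans (0≤* (0≤fromℕ (2 ℕ.* Q)) (0≤fromℕ (2 ℕ.* Q))) c²≤L
      -- The threshold for t gives c² ≤ L, and the crude bound L ≤ exp L = s² then suffices for c ≤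
      -- s.
      c≤s : c ≤ s
      c≤s = ²-cancel-≤ 0≤s (begin
        c * c     ≤⟨ c²≤L ⟩
        L         ≤⟨ ≤-by 0≤1 (solve 1 (λ l → :1 := (:1 :+ l) :- l) refl L) ⟩
        1# + L    ≤⟨ 1+x≤exp 0≤L ⟩
        exp L     ≈⟨ s² ⟨
        s * s     ∎)
      floor = even-floor Q c≤s
      2q≤s = proj₁ (proj₂ (proj₂ floor))
      s≤   = proj₂ (proj₂ (proj₂ floor))
      isM  = proj₂ (proj₂ (multipliers (proj₁ floor) (proj₁ (proj₂ floor))))

    density-bounds : ∀ {Q} → (∀ q → Q ℕ.≤ q → ∃₂ (IsMultiplier q)) →
      ∀ {t s y L e z x g} → s ≡ sqrt y → y ≡ exp L → L ≡ t * e → e ≡ exp z → z ≡ - x → g ≡ exp x →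
      fromℕ (2 ℕ.* Q) * fromℕ (2 ℕ.* Q) * g ≤ t →
      Σ (A t ≤ B t) λ _ → B t < exp (fromℕ 3 * s) * A (t - (fromℕ 5 * g) / s)
    density-bounds {Q} multipliers {t} s≡ y≡ L≡ e≡ z≡ g≡ c²g≤t =
      A≤B t , B<exp*A-eventually {Q} multipliers s≡ y≡ L≡ e≡ z≡ g≡ c²g≤t

theorem3 : (em : ExcludedMiddle 0ℓ) (ℝ : CompleteOrderedField) →
    let open CompleteOrderedField ℝ
        open Analysis em ℝ
    in
    (∀ t → Convergent (proportionσ t)) →
    (∀ t → Convergent (proportionφ t)) →
    ∃ λ t₀ → ∀ t → t₀ ≤ t →
      let y = exp (t * exp (- γ))
      in A t ≤ B t ×
         B t < exp (fromℕ 3 * sqrt y) * A (t - (fromℕ 5 * exp γ) / sqrt y)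
-- The witness for t₀ is found by unification: it is (2 Q)² exp γ, with Q the threshold from
-- `multiplier-eventually`.
theorem3 em ℝ A-convergent B-convergent = _ , λ t t₀≤t →
  density-bounds A-convergent B-convergent (proj₂ multiplier-eventually)
    ≡.refl ≡.refl ≡.refl ≡.refl ≡.refl ≡.refl t₀≤t
  where
  open Arithmetic using (multiplier-eventually)
  open RealAnalysis em ℝ using (density-bounds)
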